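{- Assume $\mathrm{FCA}^\Delta$. Then there is a family $\langle\mathbb{E}_n\rangle_{n\in\omega}$ of pairwise homeomorphic uncountable subsets of $\mathbb{R}$ such that $\mathbb{E}_0$ is entangled, $\mathbb{E}_1$ is not $2$-entangled, and for every $n\geq2$, $\mathbb{E}_n$ is $n$-entangled but not $(n+1)$-entangled.
   Context: For $1\leq k\in\omega$, an uncountable $\mathbb{E}\subseteq\mathbb{R}$ is $k$-entangled if for every $\tau:k\to2$ and every uncountable family $\mathcal{A}\subseteq[\mathbb{E}]^k$ of pairwise disjoint sets there are distinct $a,b\in\mathcal{A}$ with $a(i)<b(i)\iff\tau(i)=0$ for all $i<k$ ($a(i)$ is the $i$-th element of $a$ in increasing order); it is entangled if it is $k$-entangled for every $k\geq1$. Construction schemes: a type is a sequence $\langle m_k,n_{k+1},r_{k+1}\rangle_{k\in\omega}$ of triples of natural numbers with $m_0=1$, $n_{k+1}\geq2$, $m_k>r_{k+1}$, $m_{k+1}=r_{k+1}+(m_k-r_{k+1})n_{k+1}$. A construction scheme of this type is a family $\mathcal{F}$ of nonempty finite subsets of $\omega_1$, cofinal under $\subseteq$ among finite subsets of $\omega_1$, each member of size $m_k$ for some $k$, such that, with $\mathcal{F}_k=\{F\in\mathcal{F}:|F|=m_k\}$: (i) for $E,F\in\mathcal{F}_k$, $E\cap F$ is an initial segment of both $E$ and $F$; (ii) each $F\in\mathcal{F}_{k+1}$ equals $F_0\cup\dots\cup F_{n_{k+1}-1}$ with $F_i\in\mathcal{F}_k$ forming a $\Delta$-system with root $R(F)$,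 $|R(F)|=r_{k+1}$, $R(F)<F_0\setminus R(F)<\dots<F_{n_{k+1}-1}\setminus R(F)$ (this decomposition is unique). Let $\rho(\alpha,\beta)=\min\{k:\exists F\in\mathcal{F}_k\ \{\alpha,\beta\}\subseteq F\}$, $\|\alpha\|_k=|\{\xi<\alpha:\rho(\alpha,\xi)\leq k\}|$, and $\Delta(\alpha,\beta)$ the least $k$ with $\|\alpha\|_k\neq\|\beta\|_k$ ($\omega$ if none). Define $\Xi_\alpha:\omega\to\{ -1\}\cup\omega$ by $\Xi_\alpha(0)=0$ and, for $k\geq1$ and any $F\in\mathcal{F}_k$ with $\alpha\in F$, $\Xi_\alpha(k)=-1$ if $\alpha\in R(F)$ and $\Xi_\alpha(k)=i$ if $\alpha\in F_i\setminus R(F)$. A family $\langle D_j\rangle_{j<N}\subseteq[\omega_1]^m$, $N\geq2$, is $\Delta$-captured at level $l$ if it forms a $\Delta$-system with root $R$, $|R|=r$, with $R<D_j\setminus R$ for all $j$ and tails pairwise $<$-comparable, such that for all $a<m$ and $j<N$, $\Xi_{D_j(a)}(l)=-1$ if $a<r$ and $\Xi_{D_j(a)}(l)=j$ if $a\geq r$, and $\Delta(D_i(a),D_j(a))=l$ for distinct $i,j<N$ and $r\leq a<m$. $\mathcal{F}$ is fully $\Delta$-capturing if for every uncountable $\mathcal{S}$ of finite subsets of $\omega_1$ there are infinitely many $l$ for which some $n_l$ members of $\mathcal{S}$ can be enumerated as a family $\Delta$-captured at level $l$. $\mathrm{FCA}^\Delta$ states that for every type there is a fully $\Delta$-capturing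 construction scheme of that type. -}

module Defs where

open import Level using (Level; 0ℓ; _⊔_) renaming (suc to lsuc)
open import Data.Bool.Base using (Bool; T)
open import Data.Fin.Base as Fin using (Fin; toℕ)
open import Data.Integer.Base using (ℤ; +_; 0ℤ; -1ℤ)
open import Data.List.Base using (List; []; length)
open import Data.List.Membership.Propositional using (_∈_; _∉_)
open import Data.List.Relation.Binary.Subset.Propositional using (_⊆_)
open import Data.List.Relation.Unary.AllPairs using (AllPairs)
open import Data.Nat.Base using (ℕ; zero; suc; _+_; _*_; _∸_; _≤_; _<_)
open import Data.Product.Base using (Σ; ∃; ∃₂; ∃-syntax; _×_; _,_; proj₁)
open import Data.Rational.Base as ℚ using (ℚ)
open import Data.Sum.Base using (_⊎_)
open import Data.Vec.Base using (Vec; lookup; toList)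
import Data.Vec.Functional.Relation.Binary.Equality.Setoid as VecEq
open import Function.Bundles using (Injection; Inverse; _⇔_)
open import Induction.WellFounded using (WellFounded)
open import Relation.Binary.Bundles using (Setoid)
import Relation.Binary.Construct.On as On
open import Relation.Binary.Definitions using (_Respects_)
open import Relation.Binary.PropositionalEquality
  using (_≡_; _≢_; refl; sym; trans; setoid)
open import Relation.Binary.Structures using (IsStrictTotalOrder)
open import Relation.Nullary using (¬_)
open import Relation.Unary using (Pred)

------------------------------------------------------------------------
-- Cardinality

Subsetoid : ∀ {a ℓ p} (S : Setoid a ℓ) → Pred (Setoid.Carrier S) p →
            Setoid (a ⊔ p) ℓ
Subsetoid S P = On.setoid {B = Σ (Setoid.Carrier S) P} S proj₁

-- "At most countable".
Countable : ∀ {a ℓ} → Setoid a ℓ → Set (a ⊔ ℓ)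
Countable S = Injection S (setoid ℕ)

Uncountable : ∀ {a ℓ} → Setoid a ℓ → Set (a ⊔ ℓ)
Uncountable S = ¬ Countable S

IsLeast : ∀ {p} → Pred ℕ p → Pred ℕ p
IsLeast P k = P k × (∀ j → P j → k ≤ j)

------------------------------------------------------------------------
-- The real line

-- Dedekind lower cuts.  Under excluded middle a subset of ℚ is the same as
-- a map ℚ → Bool; using the latter keeps ℝ in Set.
record ℝ : Set where
  field
    lower     : ℚ → Bool
    inhabited : ∃[ q ] T (lower q)
    bounded   : ∃[ q ] ¬ T (lower q)
    downward  : ∀ {p q} → p ℚ.< q → T (lower q) → T (lower p)
    rounded   : ∀ {p} → T (lower p) → ∃[ q ] (p ℚ.< q × T (lower q))

open ℝ public using (lower)

infix 4 _≈ᴿ_ _<ᴿ_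

_≈ᴿ_ : ℝ → ℝ → Set
x ≈ᴿ y = ∀ q → lower x q ≡ lower y q

_<ᴿ_ : ℝ → ℝ → Set
x <ᴿ y = ∃[ q ] (¬ T (lower x q) × T (lower y q))

ℝ-setoid : Setoid 0ℓ 0ℓ
ℝ-setoid = record
  { Carrier       = ℝ
  ; _≈_           = _≈ᴿ_
  ; isEquivalence = record
    { refl  = λ _ → refl
    ; sym   = λ e q → sym (e q)
    ; trans = λ e f q → trans (e q) (f q)
    }
  }

record Subsetᴿ : Set₁ where
  field
    member   : Pred ℝ 0ℓ
    respects : member Respects _≈ᴿ_

  points : Setoid 0ℓ 0ℓ
  points = Subsetoid ℝ-setoid member

  Point : Set
  Point = Setoid.Carrier points

open Subsetᴿ public

-- Continuity for the subspace topologies, in terms of the base of ℝ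
-- consisting of the bounded open intervals.
Continuous : (A B : Subsetᴿ) → (Point A → Point B) → Set
Continuous A B f =
  ∀ (x : Point A) (a b : ℝ) → a <ᴿ proj₁ (f x) → proj₁ (f x) <ᴿ b →
  ∃₂ λ c d → (c <ᴿ proj₁ x) × (proj₁ x <ᴿ d) ×
    (∀ (y : Point A) → c <ᴿ proj₁ y → proj₁ y <ᴿ d →
      (a <ᴿ proj₁ (f y)) × (proj₁ (f y) <ᴿ b))

record Homeomorphic (A B : Subsetᴿ) : Set where
  field
    bijection       : Inverse (points A) (points B)
    to-continuous   : Continuous A B (Inverse.to bijection)
    from-continuous : Continuous B A (Inverse.from bijection)

------------------------------------------------------------------------
-- Entangled sets

open VecEq ℝ-setoid public using (_≋_; ≋-setoid)

-- [E]ᵏ, a set of size k being given by its increasing enumeration.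
[_]^ : Subsetᴿ → (k : ℕ) → Pred (Fin k → ℝ) 0ℓ
[ E ]^ k a = (∀ i → member E (a i)) × (∀ i j → i Fin.< j → a i <ᴿ a j)

PairwiseDisjoint : ∀ {k} → Pred (Fin k → ℝ) 0ℓ → Set
PairwiseDisjoint 𝒜 =
  ∀ a b → 𝒜 a → 𝒜 b → ¬ (a ≋ b) → ∀ i j → ¬ (a i ≈ᴿ b j)

-- Meaningful for k ≥ 1 and uncountable E.  The family 𝒜 need not respect _≋_:
-- it stands for the set of the ≋-classes it meets.
KEntangled : ℕ → Subsetᴿ → Set₁
KEntangled k E =
  ∀ (τ : Fin k → Fin 2) (𝒜 : Pred (Fin k → ℝ) 0ℓ) →
  (∀ a → 𝒜 a → [ E ]^ k a) →
  Uncountable (Subsetoid (≋-setoid k) 𝒜) →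
  PairwiseDisjoint 𝒜 →
  ∃₂ λ a b → 𝒜 a × 𝒜 b × ¬ (a ≋ b) ×
    (∀ i → (a i <ᴿ b i) ⇔ (τ i ≡ Fin.zero))

Entangled : Subsetᴿ → Set₁
Entangled E = ∀ k → 1 ≤ k → KEntangled k E

------------------------------------------------------------------------
-- The first uncountable ordinal

-- Up to isomorphism ω₁ is the only uncountable well-order all of whose proper
-- initial segments are countable.
record ω₁ : Set₁ where
  infix 4 _≺_
  field
    Ord                : Set
    _≺_                : Ord → Ord → Set
    isStrictTotalOrder : IsStrictTotalOrder _≡_ _≺_
    wellFounded        : WellFounded _≺_
    uncountable        : Uncountable (setoid Ord)
    segmentsCountable  : ∀ α → Countable (Subsetoid (setoid Ord) (_≺ α))

------------------------------------------------------------------------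
-- Types of construction schemes

-- The values n 0 and r 0 play no role.
record SchemeType : Set where
  field
    m n r : ℕ → ℕ
    m-zero : m 0 ≡ 1
    n≥2    : ∀ k → 2 ≤ n (suc k)
    r<m    : ∀ k → r (suc k) < m k
    m-suc  : ∀ k → m (suc k) ≡ r (suc k) + (m k ∸ r (suc k)) * n (suc k)

-- Every root size is used infinitely often.
Good : SchemeType → Set
Good τ = ∀ s b → ∃[ k ] (b ≤ k × r (suc k) ≡ s)
  where open SchemeType τ

------------------------------------------------------------------------
-- Construction schemes

module Schemes (W : ω₁) where
  open ω₁ W

  -- Finite subsets of ω₁ are represented by their increasing enumerations, so
  -- that equality of sets is equality of lists.
  Increasing : Pred (List Ord) 0ℓ
  Increasing = AllPairs _≺_

  _∖_ : List Ord → List Ord → Pred Ord 0ℓ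
  (A ∖ B) x = x ∈ A × x ∉ B

  infix 4 _≪_
  _≪_ : Pred Ord 0ℓ → Pred Ord 0ℓ → Set
  P ≪ Q = ∀ x y → P x → Q y → x ≺ y

  InitialSegment : Pred Ord 0ℓ → List Ord → Set
  InitialSegment P A =
    (∀ x → P x → x ∈ A) × (∀ x y → P x → y ∈ A → y ≺ x → P y)

  IsΔSystem : ∀ {N} → (Fin N → List Ord) → List Ord → Set
  IsΔSystem A R = ∀ i j → i ≢ j → ∀ x → (x ∈ A i × x ∈ A j) ⇔ (x ∈ R)

  module _ (τ : SchemeType) (𝓕 : Pred (List Ord) 0ℓ) where
    open SchemeType τ

    Level𝓕 : ℕ → Pred (List Ord) 0ℓ
    Level𝓕 k F = 𝓕 F × length F ≡ m k

    -- The decomposition of F ∈ 𝓕ₖ₊₁, with R(F) = root and Fᵢ = block i.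
    record Decomposition (k : ℕ) (F : List Ord) : Set where
      field
        block           : Fin (n (suc k)) → List Ord
        root            : List Ord
        block∈𝓕         : ∀ i → Level𝓕 k (block i)
        union           : ∀ x → (x ∈ F) ⇔ (∃[ i ] x ∈ block i)
        root-increasing : Increasing root
        root-size       : length root ≡ r (suc k)
        ΔSystem         : IsΔSystem block root
        root≪tails      : ∀ i → (_∈ root) ≪ (block i ∖ root)
        tails≪tails     : ∀ i j → i Fin.< j →
                          (block i ∖ root) ≪ (block j ∖ root)

    record IsConstructionScheme : Set where
      field
        increasing  : ∀ F → 𝓕 F → Increasing F
        nonempty    : ∀ F → 𝓕 F → F ≢ []
        cofinal     : ∀ A → Increasing A → ∃[ F ] (𝓕 F × A ⊆ F)
        sizes       : ∀ F → 𝓕 F → ∃[ k ] length F ≡ m k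
        coherent    : ∀ k E F → Level𝓕 k E → Level𝓕 k F →
                      InitialSegment (λ x → x ∈ E × x ∈ F) E ×
                      InitialSegment (λ x → x ∈ E × x ∈ F) F
        decomposes  : ∀ k F → Level𝓕 (suc k) F → Decomposition k F

    -- ρ(α,β) = k
    Isρ : Ord → Ord → ℕ → Set
    Isρ α β = IsLeast λ k → ∃[ F ] (Level𝓕 k F × α ∈ F × β ∈ F)

    -- ‖α‖ₖ = c
    IsNorm : Ord → ℕ → ℕ → Set
    IsNorm α k c =
      ∃[ xs ] (Increasing xs × length xs ≡ c ×
        (∀ ξ → (ξ ∈ xs) ⇔ ((ξ ≺ α) × ∃[ j ] (Isρ α ξ j × j ≤ k))))

    -- Δ(α,β) = l, for finite l
    IsΔ : Ord → Ord → ℕ → Set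
    IsΔ α β = IsLeast λ k → ∃₂ λ c d → IsNorm α k c × IsNorm β k d × c ≢ d

    -- Ξ_α(k) = v.  In a construction scheme v does not depend on the choice
    -- of F ∈ 𝓕ₖ with α ∈ F.
    data IsΞ (α : Ord) : ℕ → ℤ → Set where
      Ξ-zero : IsΞ α 0 0ℤ
      Ξ-root : ∀ {k F} → Level𝓕 (suc k) F → (D : Decomposition k F) →
               α ∈ Decomposition.root D →
               IsΞ α (suc k) -1ℤ
      Ξ-tail : ∀ {k F} → Level𝓕 (suc k) F → (D : Decomposition k F) →
               (i : Fin (n (suc k))) →
               (Decomposition.block D i ∖ Decomposition.root D) α →
               IsΞ α (suc k) (+ toℕ i)

    -- ⟨ D j ∣ j < N ⟩ ⊆ [ω₁]^s is Δ-captured at level l; lookup (D j) a is D_j(a).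
    record ΔCaptured (l : ℕ) {N s : ℕ} (D : Fin N → Vec Ord s) : Set where
      field
        N≥2             : 2 ≤ N
        increasing      : ∀ j → Increasing (toList (D j))
        root            : List Ord
        root-increasing : Increasing root
        ΔSystem         : IsΔSystem (λ j → toList (D j)) root
        root≪tails      : ∀ j → (_∈ root) ≪ (toList (D j) ∖ root)
        tails-comparable : ∀ i j → i ≢ j →
          ((toList (D i) ∖ root) ≪ (toList (D j) ∖ root)) ⊎
          ((toList (D j) ∖ root) ≪ (toList (D i) ∖ root))
        Ξ-on-root       : ∀ j a → toℕ a < length root →
                          IsΞ (lookup (D j) a) l -1ℤ
        Ξ-on-tails      : ∀ j a → length root ≤ toℕ a →
                          IsΞ (lookup (D j) a) l (+ toℕ j)
        Δ-on-tails      : ∀ i j → i ≢ j → ∀ a → length root ≤ toℕ a →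
                          IsΔ (lookup (D i) a) (lookup (D j) a) l

    -- b < l also makes l ≥ 1, so that n l is a component of the type.  The
    -- members D j are required to be distinct: ΔCaptured alone would admit a
    -- constant family equal to its root.
    FullyΔCapturing : Set₁
    FullyΔCapturing =
      ∀ (𝒮 : Pred (List Ord) 0ℓ) → (∀ A → 𝒮 A → Increasing A) →
      Uncountable (Subsetoid (setoid (List Ord)) 𝒮) →
      ∀ b → ∃[ l ] (b < l ×
        (∃₂ λ s (D : Fin (n l) → Vec Ord s) →
          (∀ j → 𝒮 (toList (D j))) ×
          (∀ i j → i ≢ j → D i ≢ D j) ×
          ΔCaptured l D))

  -- The axiom ranges over good types, as types without that property need not
  -- carry any construction scheme.  For instance, let r be constantly 0.  If
  -- E, F ∈ 𝓕ₖ meet, both lie in some G ∈ 𝓕ₗ, which splits into disjoint members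
  -- of 𝓕ₖ; coherence makes E and F blocks of that splitting, so E = F.  Hence {β : ρ(α,β) ≤ k}
  -- is finite for all k, and ω₁ would be countable.
  FCAΔ : Set₁
  FCAΔ = ∀ (τ : SchemeType) → Good τ →
    ∃[ 𝓕 ] (IsConstructionScheme τ 𝓕 × FullyΔCapturing τ 𝓕)

open Schemes public using (FCAΔ)

{-# OPTIONS --safe #-}
-- For α < ω₁ let pₖ(α) be the number of predecessors of α in any F ∈ 𝓕ₖ containing α.
-- Then pₖ₊₁(α) determines pₖ(α), and pₖ₊₁(α) = c (mₖ - rₖ₊₁) + pₖ(α) if Ξ_α(k + 1) = c ≥ 0.
-- So the ordinals are branches of a tree whose nodes of height k are the p < mₖ, where the
-- node p has the children c < nₖ₊₁ if p ≥ rₖ₊₁, and a single child otherwise.  Take ω copies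
-- of this tree and order the children of the node p in the i-th copy by some <_{p,i}.  The
-- resulting lexicographic order embeds the pairs (α,i) into ℝ.  The topology is that of the
-- tree, so all choices of the orders give homeomorphic sets.
--
-- For nₖ₊₁ = 2 · 2^(mₖ (k + 1)) the children of a node of height k are the pairs (s,ε) with
-- ε < 2 and s a matrix of signs s(p,i), p < mₖ, i ≤ k.  The order <_{p,i} compares s first
-- (reversed when i > 0), and then ε according to s(p,i).  A family captured at level k + 1
-- contains, for each s, two tuples branching into (s,0) and (s,1), so every type is realised:
-- this gives E₀.  For Eₙ with n ≥ 1 the signs s(p,0), …, s(p,n) are first made non-constant
-- by changing s(p,0) if necessary.  Then no two of the tuples ((α,0), …, (α,n)) are ordered
-- coordinatewise, while any n of the signs can still be prescribed.
module Submission where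

open import Defs
open import Axiom.ExcludedMiddle using (ExcludedMiddle)
open import Level using (0ℓ)
open import Data.Bool.Base using (T)
open import Data.Fin.Base as Fin using (Fin; toℕ; fromℕ<; combine; remQuot; opposite; finToFun; funToFin)
import Data.Fin.Properties as Fin
open import Data.Integer.Base as ℤ using (+_; +[1+_])
import Data.Integer.Properties as ℤ
open import Data.List.Base as List using (List; []; _∷_; length; filter; foldr; concat; _++_)
open import Data.List.Membership.Propositional using (_∈_; _∉_)
open import Data.List.Membership.Propositional.Properties
  using (∈-filter⁺; ∈-filter⁻; ∈-++⁺ˡ; ∈-++⁺ʳ; ∈-++⁻; ∈-concat⁺′; ∈-concat⁻′; ∈-tabulate⁺; ∈-tabulate⁻)
import Data.List.Properties as List
open import Data.List.Relation.Binary.Subset.Propositional using (_⊆_)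
open import Data.List.Relation.Unary.All as All using (All; []; _∷_)
import Data.List.Relation.Unary.All.Properties as All
open import Data.List.Relation.Unary.AllPairs using ([]; _∷_)
import Data.List.Relation.Unary.AllPairs.Properties as AllPairs
open import Data.List.Relation.Unary.Any using (here; there; index)
open import Data.Nat.Base as ℕ using (ℕ; zero; suc; _≤_; _<_; _∸_; _⊔_; z≤n; s≤s)
open import Data.Nat.Induction using (<-rec)
import Data.Nat.Properties as ℕ
open import Data.Product.Base using (Σ-syntax; ∃; ∃₂; ∃-syntax; _×_; _,_; proj₁; proj₂)
open import Data.Rational.Base as ℚ using (ℚ; ½; 0ℚ; 1ℚ; toℚᵘ; fromℚᵘ)
import Data.Rational.Properties as ℚ
open import Data.Rational.Unnormalised.Base as ℚᵘ using (mkℚᵘ; *≤*)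
import Data.Rational.Unnormalised.Properties as ℚᵘ
open import Data.Sum.Base using (_⊎_; inj₁; inj₂; [_,_]′)
open import Data.Vec.Base as Vec using (Vec; []; _∷_; lookup; tabulate; toList)
import Data.Vec.Properties as Vec
open import Function.Base using (_∘_; id)
open import Function.Bundles using (Injection; Equivalence; mk⇔; _⇔_)
open import Function.Construct.Composition using (injection)
open import Relation.Binary.Bundles using (Setoid)
open import Relation.Binary.Definitions using (tri<; tri≈; tri>)
open import Relation.Binary.PropositionalEquality
open import Relation.Binary.Structures using (IsStrictTotalOrder)
open import Relation.Nullary using (¬_; Dec; yes; no; contradiction; ¬?; _×-dec_; ⌊_⌋; toWitness; fromWitness)
open import Relation.Nullary.Decidable using (decidable-stable)
open import Relation.Unary using (Pred)

-- Halving

mid : ℚ → ℚ → ℚ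
mid p q = ½ ℚ.* (p ℚ.+ q)

½*[p+p]≡p : ∀ p → ½ ℚ.* (p ℚ.+ p) ≡ p
½*[p+p]≡p p = begin
  ½ ℚ.* (p ℚ.+ p)          ≡⟨ ℚ.*-distribˡ-+ ½ p p ⟩
  ½ ℚ.* p ℚ.+ ½ ℚ.* p      ≡⟨ ℚ.*-distribʳ-+ p ½ ½ ⟨
  1ℚ ℚ.* p                 ≡⟨ ℚ.*-identityˡ p ⟩
  p                        ∎
  where open ≡-Reasoning

p<mid : ∀ {p q} → p ℚ.< q → p ℚ.< mid p q
p<mid {p} {q} p<q = subst (ℚ._< mid p q) (½*[p+p]≡p p)
  (ℚ.*-monoʳ-<-pos ½ (ℚ.+-monoʳ-< p p<q))

mid<q : ∀ {p q} → p ℚ.< q → mid p q ℚ.< q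
mid<q {p} {q} p<q = subst (mid p q ℚ.<_) (½*[p+p]≡p q)
  (ℚ.*-monoʳ-<-pos ½ (ℚ.+-monoˡ-< q p<q))

mid≤p+½h : ∀ {p q h} → q ℚ.≤ p ℚ.+ h → mid p q ℚ.≤ p ℚ.+ ½ ℚ.* h
mid≤p+½h {p} {q} {h} q≤p+h = begin
  ½ ℚ.* (p ℚ.+ q)                  ≤⟨ ℚ.*-monoˡ-≤-nonNeg ½ (ℚ.+-monoʳ-≤ p q≤p+h) ⟩
  ½ ℚ.* (p ℚ.+ (p ℚ.+ h))          ≡⟨ cong (½ ℚ.*_) (ℚ.+-assoc p p h) ⟨
  ½ ℚ.* ((p ℚ.+ p) ℚ.+ h)          ≡⟨ ℚ.*-distribˡ-+ ½ (p ℚ.+ p) h ⟩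
  ½ ℚ.* (p ℚ.+ p) ℚ.+ ½ ℚ.* h      ≡⟨ cong (ℚ._+ ½ ℚ.* h) (½*[p+p]≡p p) ⟩
  p ℚ.+ ½ ℚ.* h                    ∎
  where open ℚ.≤-Reasoning

½^ : ℕ → ℚ
½^ zero    = 1ℚ
½^ (suc l) = ½ ℚ.* ½^ l

½^-nonNegative : ∀ l → ℚ.NonNegative (½^ l)
½^-nonNegative zero    = _
½^-nonNegative (suc l) =
  ℚ.nonNeg*nonNeg⇒nonNeg ½ (½^ l) {{½^-nonNegative l}}

-- Passing through the unnormalised rationals reduces inequalities between these numbers to
-- inequalities in `ℕ`.
1+_/1 : ℕ → ℚ
1+ l /1 = fromℚᵘ (mkℚᵘ (+ suc l) 0)

toℚᵘ-1+/1 : ∀ l → toℚᵘ (1+ l /1) ℚᵘ.≃ mkℚᵘ (+ suc l) 0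
toℚᵘ-1+/1 l = ℚ.toℚᵘ-fromℚᵘ (mkℚᵘ (+ suc l) 0)

1+/1-suc : ∀ l → 1+ suc l /1 ℚ.≤ 1+ l /1 ℚ.+ 1+ l /1
1+/1-suc l = ℚ.toℚᵘ-cancel-≤ (begin
  toℚᵘ (1+ suc l /1)                             ≃⟨ toℚᵘ-1+/1 (suc l) ⟩
  mkℚᵘ (+ suc (suc l)) 0                         ≤⟨ *≤* (ℤ.+≤+ (ℕ.*-monoˡ-≤ 1 2+l≤)) ⟩
  mkℚᵘ (+ suc l) 0 ℚᵘ.+ mkℚᵘ (+ suc l) 0         ≃⟨ ℚᵘ.+-cong (toℚᵘ-1+/1 l) (toℚᵘ-1+/1 l) ⟨
  toℚᵘ (1+ l /1) ℚᵘ.+ toℚᵘ (1+ l /1)             ≃⟨ ℚ.toℚᵘ-homo-+ (1+ l /1) (1+ l /1) ⟨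
  toℚᵘ (1+ l /1 ℚ.+ 1+ l /1)                     ∎)
  where
  open ℚᵘ.≤-Reasoning
  2+l≤ : suc (suc l) ≤ suc l ℕ.* 1 ℕ.+ suc l ℕ.* 1
  2+l≤ rewrite ℕ.*-identityʳ l | ℕ.+-suc l l = s≤s (s≤s (ℕ.m≤m+n l l))

-- The bound 1 + l ≤ 2^l, multiplied out to avoid division; the induction rests on 2 + l ≤ 2 (1 +
-- l).
½^*1+≤1 : ∀ l → ½^ l ℚ.* 1+ l /1 ℚ.≤ 1ℚ
½^*1+≤1 zero    = ℚ.≤-refl
½^*1+≤1 (suc l) = begin
  (½ ℚ.* h) ℚ.* 1+ suc l /1              ≤⟨ ℚ.*-monoˡ-≤-nonNeg (½ ℚ.* h) {{½^-nonNegative (suc l)}} (1+/1-suc l) ⟩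
  (½ ℚ.* h) ℚ.* (1+ l /1 ℚ.+ 1+ l /1)    ≡⟨ cong (ℚ._* (1+ l /1 ℚ.+ 1+ l /1)) (ℚ.*-comm ½ h) ⟩
  (h ℚ.* ½) ℚ.* (1+ l /1 ℚ.+ 1+ l /1)    ≡⟨ ℚ.*-assoc h ½ _ ⟩
  h ℚ.* (½ ℚ.* (1+ l /1 ℚ.+ 1+ l /1))    ≡⟨ cong (h ℚ.*_) (½*[p+p]≡p (1+ l /1)) ⟩
  h ℚ.* 1+ l /1                          ≤⟨ ½^*1+≤1 l ⟩
  1ℚ                                     ∎
  where
  open ℚ.≤-Reasoning
  h = ½^ l

-- For e = (n + 1) / (d + 1) the exponent d suffices, as 2^d ≥ d + 1 and hence e is at least 1 / (d
-- + 1).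
½^-archimedean : ∀ e → .{{ℚ.Positive e}} → ∃[ l ] ½^ l ℚ.≤ e
½^-archimedean e@(ℚ.mkℚ +[1+ n ] d _) = d , ℚ.*-cancelʳ-≤-pos (1+ d /1) {{pos}} (ℚ.≤-trans (½^*1+≤1 d) 1≤)
  where
  pos : ℚ.Positive (1+ d /1)
  pos = ℚ.positive (ℚ.toℚᵘ-cancel-< (ℚᵘ.<-respʳ-≃ (ℚᵘ.≃-sym (toℚᵘ-1+/1 d)) (ℚᵘ.*<* (ℤ.+<+ (s≤s z≤n)))))
  1≤ : 1ℚ ℚ.≤ e ℚ.* 1+ d /1
  1≤ = ℚ.toℚᵘ-cancel-≤ (begin
    toℚᵘ 1ℚ                                        ≤⟨ *≤* (ℤ.+≤+ le) ⟩
    toℚᵘ e ℚᵘ.* mkℚᵘ (+ suc d) 0                   ≃⟨ ℚᵘ.*-congˡ {toℚᵘ e} (toℚᵘ-1+/1 d) ⟨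
    toℚᵘ e ℚᵘ.* toℚᵘ (1+ d /1)                     ≃⟨ ℚ.toℚᵘ-homo-* e (1+ d /1) ⟨
    toℚᵘ (e ℚ.* 1+ d /1)                           ∎)
    where
    open ℚᵘ.≤-Reasoning
    le : 1 ℕ.* suc (d ℕ.* 1) ≤ suc n ℕ.* suc d ℕ.* 1
    le rewrite ℕ.*-identityʳ d | ℕ.+-identityʳ d | ℕ.*-identityʳ (suc n ℕ.* suc d) = s≤s (ℕ.m≤m+n d (n ℕ.* suc d))

p+½^l≤q : ∀ {p q} → p ℚ.< q → ∃[ l ] p ℚ.+ ½^ l ℚ.≤ q
p+½^l≤q {p} {q} p<q =
  let l , ½^l≤ = ½^-archimedean (q ℚ.- p) {{ℚ.positive 0<q-p}} in l , (begin
    p ℚ.+ ½^ l                  ≤⟨ ℚ.+-monoʳ-≤ p ½^l≤ ⟩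
    p ℚ.+ (q ℚ.- p)             ≡⟨ ℚ.+-comm p _ ⟩
    (q ℚ.- p) ℚ.+ p             ≡⟨ ℚ.+-assoc q _ p ⟩
    q ℚ.+ (ℚ.- p ℚ.+ p)         ≡⟨ cong (q ℚ.+_) (ℚ.+-inverseˡ p) ⟩
    q ℚ.+ 0ℚ                    ≡⟨ ℚ.+-identityʳ q ⟩
    q                           ∎)
  where
  open ℚ.≤-Reasoning
  0<q-p : 0ℚ ℚ.< q ℚ.- p
  0<q-p = subst (ℚ._< q ℚ.- p) (ℚ.+-inverseʳ p) (ℚ.+-monoˡ-< (ℚ.- p) p<q)

-- Nested intervals coding sequences of natural numbers

record Interval : Set where
  constructor interval
  field
    {left right} : ℚ
    left<right   : left ℚ.< right

open Interval

leftHalf rightHalf : Interval → Interval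
leftHalf  I = interval (p<mid (left<right I))
rightHalf I = interval (mid<q (left<right I))

-- Infinitely many subintervals from left to right: child 0 lies in the left half, the later ones in
-- the right half. Child 0 is kept away from both ends of that half, so all inclusions and
-- separations are strict.
child : ℕ → Interval → Interval
child zero    I = leftHalf (rightHalf (leftHalf I))
child (suc c) I = child c (rightHalf I)

left<child : ∀ c I → left I ℚ.< left (child c I)
left<child zero    I = p<mid (left<right (leftHalf I))
left<child (suc c) I =
  ℚ.<-trans (p<mid (left<right I)) (left<child c (rightHalf I))

child<right : ∀ c I → right (child c I) ℚ.< right I
child<right zero    I =
  ℚ.<-trans (mid<q (left<right (rightHalf (leftHalf I)))) (mid<q (left<right I))
child<right (suc c) I = child<right c (rightHalf I)

child-separated : ∀ {c d} I → c < d → right (child c I) ℚ.< left (child d I)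
child-separated {zero}  {suc d} I _         =
  ℚ.<-trans (mid<q (left<right (rightHalf (leftHalf I)))) (left<child d (rightHalf I))
child-separated {suc c} {suc d} I (s≤s c<d) = child-separated (rightHalf I) c<d

-- Child 0 lies inside a half of `I`, and replacing `I` by its right half keeps the bound `h`.
child-short : ∀ c I h → right I ℚ.≤ left I ℚ.+ h →
              right (child c I) ℚ.≤ left (child c I) ℚ.+ ½ ℚ.* h
child-short zero    I h short = ℚ.≤-trans
  (ℚ.<⇒≤ (mid<q (left<right (rightHalf (leftHalf I)))))
  (ℚ.≤-trans (mid≤p+½h {left I} {right I} {h} short) (ℚ.+-monoˡ-≤ (½ ℚ.* h) (ℚ.<⇒≤ (left<child 0 I))))
child-short (suc c) I h short = child-short c (rightHalf I) h
  (ℚ.≤-trans short (ℚ.+-monoˡ-≤ h (ℚ.<⇒≤ (p<mid (left<right I)))))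

Sequence : Set
Sequence = ℕ → ℕ

Agree : ℕ → Sequence → Sequence → Set
Agree l x y = ∀ k → k < l → x k ≡ y k

agree-sym : ∀ {l x y} → Agree l x y → Agree l y x
agree-sym e k k<l = sym (e k k<l)

_<ˡᵉˣ_ : Sequence → Sequence → Set
x <ˡᵉˣ y = ∃[ l ] (Agree l x y × x l < y l)

agree? : ∀ l x y → Agree l x y ⊎ (∃[ k ] (k < l × Agree k x y × x k ≢ y k))
agree? zero    x y = inj₁ λ _ ()
agree? (suc l) x y with agree? l x y
... | inj₂ (k , k<l , e , ne) = inj₂ (k , ℕ.m<n⇒m<1+n k<l , e , ne)
... | inj₁ e with x l ℕ.≟ y l
...   | no ne  = inj₂ (l , ℕ.≤-refl , e , ne)
...   | yes eq = inj₁ λ k k<1+l → case-split k (ℕ.m≤n⇒m<n∨m≡n (ℕ.≤-pred k<1+l))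
  where
  case-split : ∀ k → k < l ⊎ k ≡ l → x k ≡ y k
  case-split k (inj₁ k<l)  = e k k<l
  case-split k (inj₂ refl) = eq

node : Sequence → ℕ → Interval
node x zero    = interval {0ℚ} {1ℚ} (ℚ.positive⁻¹ 1ℚ)
node x (suc l) = child (x l) (node x l)

node-cong : ∀ {x y} l → Agree l x y → node x l ≡ node y l
node-cong zero    _ = refl
node-cong (suc l) e = cong₂ child (e l ℕ.≤-refl)
  (node-cong l λ k k<l → e k (ℕ.m<n⇒m<1+n k<l))

left-mono : ∀ x {k l} → k ≤ l → left (node x k) ℚ.≤ left (node x l)
left-mono x k≤l = go (ℕ.≤⇒≤′ k≤l)
  where
  go : ∀ {k l} → k ℕ.≤′ l → left (node x k) ℚ.≤ left (node x l)
  go ℕ.≤′-refl       = ℚ.≤-refl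
  go {l = suc l} (ℕ.≤′-step k≤l) =
    ℚ.≤-trans (go k≤l) (ℚ.<⇒≤ (left<child (x l) (node x l)))

right-anti : ∀ x {k l} → k ≤ l → right (node x l) ℚ.≤ right (node x k)
right-anti x k≤l = go (ℕ.≤⇒≤′ k≤l)
  where
  go : ∀ {k l} → k ℕ.≤′ l → right (node x l) ℚ.≤ right (node x k)
  go ℕ.≤′-refl       = ℚ.≤-refl
  go {l = suc l} (ℕ.≤′-step k≤l) =
    ℚ.≤-trans (ℚ.<⇒≤ (child<right (x l) (node x l))) (go k≤l)

left<right-all : ∀ x k l → left (node x k) ℚ.< right (node x l)
left<right-all x k l = ℚ.≤-<-trans (left-mono x (ℕ.m≤m⊔n k l))
  (ℚ.<-≤-trans (left<right (node x (k ⊔ l))) (right-anti x (ℕ.m≤n⊔m k l)))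

node-short : ∀ x l → right (node x l) ℚ.≤ left (node x l) ℚ.+ ½^ l
node-short x zero    = ℚ.≤-refl
node-short x (suc l) = child-short (x l) (node x l) (½^ l) (node-short x l)

node-separated : ∀ {x y} k → Agree k x y → x k < y k →
                 right (node x (suc k)) ℚ.< left (node y (suc k))
node-separated {x} {y} k e x<y rewrite node-cong k e = child-separated (node y k) x<y

-- Embedding of sequences into the real line

module Embedding (em : ∀ {ℓ} → ExcludedMiddle ℓ) where

  -- The supremum of the left endpoints of the nested nodes; excluded middle makes the cut Boolean.
  embed : Sequence → ℝ
  embed x = record
    { lower     = λ q → ⌊ below? q ⌋
    ; inhabited = left (node x 0) , fromWitness {a? = below? _} (1 , left<child (x 0) (node x 0))
    ; bounded   = right (node x 0) , λ b → let l , r<l = toWitness {a? = below? _} b in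
                    ℚ.<-asym r<l (left<right-all x l 0)
    ; downward  = λ {p} {q} p<q b → let l , q<l = toWitness {a? = below? q} b in
                    fromWitness {a? = below? p} (l , ℚ.<-trans p<q q<l)
    ; rounded   = λ {p} b → let l , p<l = toWitness {a? = below? p} b
                                q , p<q , q<l = ℚ.<-dense p<l in
                    q , p<q , fromWitness {a? = below? q} (l , q<l)
    }
    where
    below? : ∀ q → Dec (∃[ l ] q ℚ.< left (node x l))
    below? q = em

  embed⁺ : ∀ x {q} l → q ℚ.< left (node x l) → T (lower (embed x) q)
  embed⁺ x l q<l = fromWitness (l , q<l)

  embed⁻ : ∀ x {q} → T (lower (embed x) q) → ∃[ l ] q ℚ.< left (node x l)
  embed⁻ x = toWitness

  embed-right : ∀ x {q} l → right (node x l) ℚ.≤ q → ¬ T (lower (embed x) q)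
  embed-right x l r≤q b = let k , q<k = embed⁻ x b in
    ℚ.<-asym (ℚ.<-≤-trans (left<right-all x k l) r≤q) q<k

  embed-mono : ∀ {x y} → x <ˡᵉˣ y → embed x <ᴿ embed y
  embed-mono {x} {y} (k , e , x<y) = right (node x (suc k)) ,
    embed-right x (suc k) ℚ.≤-refl , embed⁺ y (suc k) (node-separated k e x<y)

  -- Rational cuts serve as the real endpoints that `Continuous` asks for.
  ⟦_⟧ : ℚ → ℝ
  ⟦ c ⟧ = record
    { lower     = λ q → ⌊ q ℚ.<? c ⌋
    ; inhabited = c ℚ.- 1ℚ , fromWitness {a? = _ ℚ.<? c} c-1<c
    ; bounded   = c , λ b → ℚ.<-irrefl refl (toWitness {a? = c ℚ.<? c} b)
    ; downward  = λ {p} {q} p<q b → fromWitness {a? = p ℚ.<? c} (ℚ.<-trans p<q (toWitness {a? = q ℚ.<? c} b))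
    ; rounded   = λ {p} b → let q , p<q , q<c = ℚ.<-dense (toWitness {a? = p ℚ.<? c} b) in
                    q , p<q , fromWitness {a? = q ℚ.<? c} q<c
    }
    where
    c-1<c : c ℚ.- 1ℚ ℚ.< c
    c-1<c = subst (c ℚ.- 1ℚ ℚ.<_) (ℚ.+-identityʳ c) (ℚ.+-monoʳ-< c (ℚ.negative⁻¹ (ℚ.- 1ℚ)))

  ⟦⟧⁺ : ∀ {c q} → q ℚ.< c → T (lower ⟦ c ⟧ q)
  ⟦⟧⁺ q<c = fromWitness q<c

  ⟦⟧⁻ : ∀ {c q} → T (lower ⟦ c ⟧ q) → q ℚ.< c
  ⟦⟧⁻ = toWitness

  lower<upper : ∀ x {p q} → T (lower x p) → ¬ T (lower x q) → p ℚ.< q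
  lower<upper x {p} {q} p∈x q∉x with ℚ.<-cmp p q
  ... | tri< p<q _ _ = p<q
  ... | tri≈ _ refl _ = contradiction p∈x q∉x
  ... | tri> _ _ q<p = contradiction (ℝ.downward x q<p p∈x) q∉x

  <ᴿ-asym : ∀ x y → x <ᴿ y → ¬ (y <ᴿ x)
  <ᴿ-asym x y (q , q∉x , q∈y) (p , p∉y , p∈x) =
    ℚ.<-asym (lower<upper x p∈x q∉x) (lower<upper y q∈y p∉y)

  <ᴿ-resp : ∀ x x′ y y′ → x ≈ᴿ x′ → y ≈ᴿ y′ → x <ᴿ y → x′ <ᴿ y′
  <ᴿ-resp _ _ _ _ x≈ y≈ (q , q∉x , q∈y) =
    q , (λ q∈x′ → q∉x (subst T (sym (x≈ q)) q∈x′)) , subst T (y≈ q) q∈y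

  ≈ᴿ-sym : ∀ x y → x ≈ᴿ y → y ≈ᴿ x
  ≈ᴿ-sym _ _ e q = sym (e q)

  ≈ᴿ-trans : ∀ x y z → x ≈ᴿ y → y ≈ᴿ z → x ≈ᴿ z
  ≈ᴿ-trans _ _ _ e f q = trans (e q) (f q)

  <ᴿ-irrefl : ∀ x y → x ≈ᴿ y → ¬ (x <ᴿ y)
  <ᴿ-irrefl x y x≈y x<y = <ᴿ-asym x y x<y (<ᴿ-resp x y y x x≈y (≈ᴿ-sym x y x≈y) x<y)

  -- At a first difference k < l the nodes of height k + 1 are separated, and `embed y` lies in its
  -- own node, hence outside that of `x`.
  node-nbhd : ∀ x y l → ⟦ left (node x l) ⟧ <ᴿ embed y → embed y <ᴿ ⟦ right (node x l) ⟧ → Agree l x y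
  node-nbhd x y l (p , p∉ , p∈y) (q , q∉y , q∈) with agree? l x y
  ... | inj₁ e = e
  ... | inj₂ (k , k<l , e , ne) with ℕ.<-cmp (x k) (y k)
  ...   | tri≈ _ eq _ = contradiction eq ne
  ...   | tri< x<y _ _ = contradiction
    (embed⁺ y (suc k) (ℚ.<-trans (ℚ.<-≤-trans (⟦⟧⁻ q∈) (right-anti x k<l)) (node-separated k e x<y))) q∉y
  ...   | tri> _ _ y<x = contradiction (⟦⟧⁺ p<left) p∉
    where
    p<left : p ℚ.< left (node x l)
    p<left = let j , p<j = embed⁻ y p∈y in
      ℚ.<-≤-trans (ℚ.<-trans p<j (ℚ.<-trans (left<right-all y j (suc k))
        (node-separated k (agree-sym e) y<x))) (left-mono x k<l)

  left<embed : ∀ x l → ⟦ left (node x l) ⟧ <ᴿ embed x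
  left<embed x l = left (node x l) , (λ b → ℚ.<-irrefl refl (⟦⟧⁻ b)) ,
    embed⁺ x (suc l) (left<child (x l) (node x l))

  embed<right : ∀ x l → embed x <ᴿ ⟦ right (node x l) ⟧
  embed<right x l = right (node x (suc l)) , embed-right x (suc l) ℚ.≤-refl , ⟦⟧⁺ (child<right (x l) (node x l))

  nbhd-left : ∀ a x → a <ᴿ embed x → ∃[ l ] ∀ y → Agree l x y → a <ᴿ embed y
  nbhd-left a x (q , q∉a , q∈x) = let l , q<l = embed⁻ x q∈x in
    l , λ y e → q , q∉a , embed⁺ y l (subst (λ I → q ℚ.< left I) (node-cong l e) q<l)

  -- Unlike on the left, the cut gives no endpoint directly: the left endpoints stay below `q`, and
  -- once the node is shorter than `q′ - q` its right endpoint is below `q′`.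
  nbhd-right : ∀ b x → embed x <ᴿ b → ∃[ l ] ∀ y → Agree l x y → embed y <ᴿ b
  nbhd-right b x (q , q∉x , q∈b) with ℝ.rounded b q∈b
  ... | q′ , q<q′ , q′∈b with p+½^l≤q q<q′
  ...   | l , q+½^l≤q′ = l , λ y e → q′ ,
    embed-right y l (subst (λ I → right I ℚ.≤ q′) (node-cong l e)
      (ℚ.≤-trans (node-short x l) (ℚ.≤-trans (ℚ.+-monoˡ-≤ (½^ l) left≤q) q+½^l≤q′))) , q′∈b
    where
    left≤q : left (node x l) ℚ.≤ q
    left≤q = ℚ.≮⇒≥ λ q<l → q∉x (embed⁺ x l q<l)

  embed-injective : ∀ {x y} → embed x ≈ᴿ embed y → ∀ l → Agree l x y
  embed-injective {x} {y} x≈y l = node-nbhd x y l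
    (<ᴿ-resp ⟦ left (node x l) ⟧ ⟦ left (node x l) ⟧ (embed x) (embed y) (λ _ → refl) x≈y (left<embed x l))
    (<ᴿ-resp (embed x) (embed y) ⟦ right (node x l) ⟧ ⟦ right (node x l) ⟧ x≈y (λ _ → refl) (embed<right x l))

-- Countability

-- Injective though not onto: the values with a + b = s lie between s² and s² + s, below (s + 1)².
pair : ℕ → ℕ → ℕ
pair a b = (a ℕ.+ b) ℕ.* (a ℕ.+ b) ℕ.+ a

pair-<-sum : ∀ a b c d → a ℕ.+ b < c ℕ.+ d → pair a b < pair c d
pair-<-sum a b c d s<t = begin-strict
  s ℕ.* s ℕ.+ a            ≤⟨ ℕ.+-monoʳ-≤ (s ℕ.* s) (ℕ.m≤m+n a b) ⟩
  s ℕ.* s ℕ.+ s            ≡⟨ ℕ.+-comm (s ℕ.* s) s ⟩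
  suc s ℕ.* s              <⟨ ℕ.*-monoʳ-< (suc s) (ℕ.n<1+n s) ⟩
  suc s ℕ.* suc s          ≤⟨ ℕ.*-mono-≤ s<t s<t ⟩
  (c ℕ.+ d) ℕ.* (c ℕ.+ d)  ≤⟨ ℕ.m≤m+n _ c ⟩
  pair c d                 ∎
  where
  open ℕ.≤-Reasoning
  s = a ℕ.+ b

pair-injective : ∀ {a b c d} → pair a b ≡ pair c d → a ≡ c × b ≡ d
pair-injective {a} {b} {c} {d} e with ℕ.<-cmp (a ℕ.+ b) (c ℕ.+ d)
... | tri< s<t _ _ = contradiction e (ℕ.<⇒≢ (pair-<-sum a b c d s<t))
... | tri> _ _ t<s = contradiction (sym e) (ℕ.<⇒≢ (pair-<-sum c d a b t<s))
... | tri≈ _ s≡t _ = a≡c , ℕ.+-cancelˡ-≡ a b d (trans s≡t (cong (ℕ._+ d) (sym a≡c)))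
  where
  a≡c : a ≡ c
  a≡c = ℕ.+-cancelˡ-≡ ((a ℕ.+ b) ℕ.* (a ℕ.+ b)) a c
    (trans e (cong (λ t → t ℕ.* t ℕ.+ c) (sym s≡t)))

m≤m*m : ∀ m → m ≤ m ℕ.* m
m≤m*m zero    = z≤n
m≤m*m (suc m) = ℕ.m≤m+n (suc m) (m ℕ.* suc m)

pair-≥₁ : ∀ a b → a ≤ pair a b
pair-≥₁ a b = ℕ.m≤n+m a _

pair-≥₂ : ∀ a b → b ≤ pair a b
pair-≥₂ a b = ℕ.≤-trans (ℕ.≤-trans (ℕ.m≤n+m b a) (m≤m*m (a ℕ.+ b))) (ℕ.m≤m+n _ a)

encode : ∀ {k} → Vec ℕ k → ℕ
encode []       = 0
encode (x ∷ xs) = pair x (encode xs)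

encode-injective : ∀ {k} {xs ys : Vec ℕ k} → encode xs ≡ encode ys → xs ≡ ys
encode-injective {xs = []}     {[]}     _ = refl
encode-injective {xs = x ∷ xs} {y ∷ ys} e with pair-injective {x} {encode xs} {y} {encode ys} e
... | refl , e′ = cong (x ∷_) (encode-injective e′)

uncountable-injection : ∀ {a b ℓ ℓ′} {S : Setoid a ℓ} {T : Setoid b ℓ′} →
                        Injection S T → Uncountable S → Uncountable T
uncountable-injection f S-unc g = S-unc (injection f g)

-- The number of the fibre is paired with the code inside the fibre. `code` takes the number of the
-- fibre as a variable, so that equal numbers can be identified before codes are compared.
countable-union : ∀ {X : Set} (V : Pred X 0ℓ) (c : X → ℕ) →
  (∀ k → Countable (Subsetoid (setoid X) (λ x → V x × c x ≡ k))) →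
  Countable (Subsetoid (setoid X) V)
countable-union V c fibre = record
  { to        = λ (x , v) → pair (c x) (code x v refl)
  ; cong      = λ {(x , _)} {(y , _)} x≡y → cong₂ pair (cong c x≡y) (congruent (cong c x≡y) x≡y)
  ; injective = λ {(x , v)} {(y , w)} e →
      let e₁ , e₂ = pair-injective {c x} {code x v refl} {c y} {code y w refl} e in injective e₁ e₂
  }
  where
  code : ∀ {k} x → V x → c x ≡ k → ℕ
  code {k} x v e = Injection.to (fibre k) (x , v , e)
  congruent : ∀ {k l x y v w e f} → k ≡ l → x ≡ y → code {k} x v e ≡ code {l} y w f
  congruent {k} refl refl = Injection.cong (fibre k) refl
  injective : ∀ {k l x y v w e f} → k ≡ l → code {k} x v e ≡ code {l} y w f → x ≡ y
  injective {k} refl = Injection.injective (fibre k)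

module Classical (em : ∀ {ℓ} → ExcludedMiddle ℓ) where
  open Embedding em

  uncountable-fibre : ∀ {X : Set} (V : Pred X 0ℓ) (c : X → ℕ) →
    Uncountable (Subsetoid (setoid X) V) →
    ∃[ k ] Uncountable (Subsetoid (setoid X) (λ x → V x × c x ≡ k))
  uncountable-fibre V c V-unc = decidable-stable em λ none →
    V-unc (countable-union V c λ k → decidable-stable em λ unc → none (k , unc))

  -- Sets of reals given by families of sequences

  range : {X : Set} → (X → Sequence) → Subsetᴿ
  range f = record
    { member   = λ z → ∃[ x ] z ≈ᴿ embed (f x)
    ; respects = λ {z} {z′} z≈z′ (x , e) → x , ≈ᴿ-trans z′ z (embed (f x)) (≈ᴿ-sym z z′ z≈z′) e
    }

  Separating : {X : Set} → (X → Sequence) → Set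
  Separating f = ∀ x y → (∀ l → Agree l (f x) (f y)) → x ≡ y

  index-unique : ∀ {X : Set} {f : X → Sequence} → Separating f →
    ∀ {z z′ x x′} → z ≈ᴿ embed (f x) → z′ ≈ᴿ embed (f x′) → z ≈ᴿ z′ → x ≡ x′
  index-unique {f = f} sep {z} {z′} {x} {x′} e e′ z≈z′ = sep x x′ (embed-injective
    (≈ᴿ-trans (embed (f x)) z (embed (f x′)) (≈ᴿ-sym z (embed (f x)) e)
      (≈ᴿ-trans z z′ (embed (f x′)) z≈z′ e′)))

  module _ {X : Set} {f g : X → Sequence}
           (f⇒g : ∀ l x y → Agree l (f x) (f y) → Agree l (g x) (g y)) where

    -- A neighbourhood of `g x` contains everything agreeing with `g x` up to some height l; the
    -- node of `f x` at height l forces agreement for `f`, which transfers to `g`.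
    transport-continuous : (h : Point (range f) → Point (range g)) →
      (∀ z → proj₁ (h z) ≈ᴿ embed (g (proj₁ (proj₂ z)))) →
      Continuous (range f) (range g) h
    transport-continuous h hz p@(z , x , e) a b a<hz hz<b =
      let hx   = proj₁ (h p)
          l₁ , near₁ = nbhd-left a (g x) (<ᴿ-resp a a hx (embed (g x)) (λ _ → refl) (hz p) a<hz)
          l₂ , near₂ = nbhd-right b (g x) (<ᴿ-resp hx (embed (g x)) b b (hz p) (λ _ → refl) hz<b)
          l  = l₁ ⊔ l₂
          c  = ⟦ Interval.left (node (f x) l) ⟧
          d  = ⟦ Interval.right (node (f x) l) ⟧
          z≈ = ≈ᴿ-sym z (embed (f x)) e
      in c , d ,
         <ᴿ-resp c c (embed (f x)) z (λ _ → refl) z≈ (left<embed (f x) l) ,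
         <ᴿ-resp (embed (f x)) z d d z≈ (λ _ → refl) (embed<right (f x) l) ,
         λ q@(w , y , e′) c<w w<d →
           let agree = f⇒g l x y (node-nbhd (f x) (f y) l
                 (<ᴿ-resp c c w (embed (f y)) (λ _ → refl) e′ c<w)
                 (<ᴿ-resp w (embed (f y)) d d e′ (λ _ → refl) w<d))
               hy  = proj₁ (h q)
               hy≈ = ≈ᴿ-sym hy (embed (g y)) (hz q)
           in <ᴿ-resp a a (embed (g y)) hy (λ _ → refl) hy≈
                (near₁ (g y) λ k k<l₁ → agree k (ℕ.<-≤-trans k<l₁ (ℕ.m≤m⊔n l₁ l₂))) ,
              <ᴿ-resp (embed (g y)) hy b b hy≈ (λ _ → refl)
                (near₂ (g y) λ k k<l₂ → agree k (ℕ.<-≤-trans k<l₂ (ℕ.m≤n⊔m l₁ l₂)))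

  -- Points with the same index correspond. The topology of each range is given by its agreement
  -- relations, and these are the same for `f` and `g`.
  range-homeomorphic : ∀ {X : Set} {f g : X → Sequence} →
    (∀ l x y → Agree l (f x) (f y) → Agree l (g x) (g y)) →
    (∀ l x y → Agree l (g x) (g y) → Agree l (f x) (f y)) →
    Separating f → Homeomorphic (range f) (range g)
  range-homeomorphic {X} {f} {g} f⇒g g⇒f f-sep = record
    { bijection = record
      { to        = to
      ; from      = from
      ; to-cong   = λ {p} {q} → to-cong p q
      ; from-cong = λ {p} {q} → from-cong p q
      ; inverse   = (λ {p} {q} e → ≈ᴿ-trans (proj₁ (to q)) (proj₁ (to (from p))) (proj₁ p) (to-cong q (from p) e)
                       (≈ᴿ-sym (proj₁ p) (proj₁ (to (from p))) (proj₂ (proj₂ p)))) ,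
                    (λ {p} {q} e → ≈ᴿ-trans (proj₁ (from q)) (proj₁ (from (to p))) (proj₁ p) (from-cong q (to p) e)
                       (≈ᴿ-sym (proj₁ p) (proj₁ (from (to p))) (proj₂ (proj₂ p))))
      }
    ; to-continuous   = transport-continuous f⇒g to λ _ _ → refl
    ; from-continuous = transport-continuous g⇒f from λ _ _ → refl
    }
    where
    to : Point (range f) → Point (range g)
    to (_ , x , _) = embed (g x) , x , λ _ → refl
    from : Point (range g) → Point (range f)
    from (_ , x , _) = embed (f x) , x , λ _ → refl
    g-sep : Separating g
    g-sep x y e = f-sep x y λ l → g⇒f l x y (e l)
    to-cong : ∀ p q → proj₁ p ≈ᴿ proj₁ q → proj₁ (to p) ≈ᴿ proj₁ (to q)
    to-cong (z , _ , e) (w , _ , e′) z≈w with index-unique f-sep {z} {w} e e′ z≈w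
    ... | refl = λ _ → refl
    from-cong : ∀ p q → proj₁ p ≈ᴿ proj₁ q → proj₁ (from p) ≈ᴿ proj₁ (from q)
    from-cong (z , _ , e) (w , _ , e′) z≈w with index-unique g-sep {z} {w} e e′ z≈w
    ... | refl = λ _ → refl

-- Increasing lists of ordinals

module _ {A : Set} where

  lookup-index : ∀ {s} (D : Vec A s) {xs x} → toList D ≡ xs → (x∈xs : x ∈ xs) →
                 ∃[ a ] (lookup D a ≡ x × toℕ a ≡ toℕ (index x∈xs))
  lookup-index (y ∷ D) refl (here refl) = Fin.zero , refl , refl
  lookup-index (y ∷ D) refl (there x∈)  =
    let a , e , e′ = lookup-index D refl x∈ in Fin.suc a , e , cong suc e′

  index-injective : ∀ {xs : List A} {x y} (x∈ : x ∈ xs) (y∈ : y ∈ xs) →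
                    toℕ (index x∈) ≡ toℕ (index y∈) → x ≡ y
  index-injective (here refl) (here refl) _ = refl
  index-injective (there x∈)  (there y∈)  e = index-injective x∈ y∈ (ℕ.suc-injective e)

  index-resp : ∀ {xs ys : List A} {x y} → xs ≡ ys → (x∈ : x ∈ xs) (y∈ : y ∈ ys) →
               toℕ (index x∈) ≡ toℕ (index y∈) → x ≡ y
  index-resp refl = index-injective

module Ordinals (W : ω₁) where
  open ω₁ W public
  open Schemes W public
  module STO = IsStrictTotalOrder isStrictTotalOrder
  open STO public using (compare; _≟_; irrefl) renaming (_<?_ to _≺?_; trans to ≺-trans; asym to ≺-asym)

  ≺-irrefl : ∀ {x} → ¬ (x ≺ x)
  ≺-irrefl = irrefl refl

  insert : Ord → List Ord → List Ord
  insert x []       = x ∷ []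
  insert x (y ∷ ys) with compare x y
  ... | tri< _ _ _ = x ∷ y ∷ ys
  ... | tri≈ _ _ _ = y ∷ ys
  ... | tri> _ _ _ = y ∷ insert x ys

  ∈-insert⁻ : ∀ x ys {z} → z ∈ insert x ys → z ≡ x ⊎ z ∈ ys
  ∈-insert⁻ x []       (here e) = inj₁ e
  ∈-insert⁻ x (y ∷ ys) z∈ with compare x y
  ∈-insert⁻ x (y ∷ ys) (here e)   | tri< _ _ _ = inj₁ e
  ∈-insert⁻ x (y ∷ ys) (there z∈) | tri< _ _ _ = inj₂ z∈
  ∈-insert⁻ x (y ∷ ys) z∈         | tri≈ _ _ _ = inj₂ z∈
  ∈-insert⁻ x (y ∷ ys) (here e)   | tri> _ _ _ = inj₂ (here e)
  ∈-insert⁻ x (y ∷ ys) (there z∈) | tri> _ _ _ with ∈-insert⁻ x ys z∈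
  ... | inj₁ e   = inj₁ e
  ... | inj₂ z∈′ = inj₂ (there z∈′)

  ∈-insert⁺ˡ : ∀ x ys → x ∈ insert x ys
  ∈-insert⁺ˡ x []       = here refl
  ∈-insert⁺ˡ x (y ∷ ys) with compare x y
  ... | tri< _ _ _ = here refl
  ... | tri≈ _ e _ = here e
  ... | tri> _ _ _ = there (∈-insert⁺ˡ x ys)

  ∈-insert⁺ʳ : ∀ x ys → ys ⊆ insert x ys
  ∈-insert⁺ʳ x (y ∷ ys) z∈ with compare x y
  ∈-insert⁺ʳ x (y ∷ ys) z∈         | tri< _ _ _ = there z∈
  ∈-insert⁺ʳ x (y ∷ ys) z∈         | tri≈ _ _ _ = z∈
  ∈-insert⁺ʳ x (y ∷ ys) (here e)   | tri> _ _ _ = here e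
  ∈-insert⁺ʳ x (y ∷ ys) (there z∈) | tri> _ _ _ = there (∈-insert⁺ʳ x ys z∈)

  insert-increasing : ∀ x {ys} → Increasing ys → Increasing (insert x ys)
  insert-increasing x {[]}     []          = [] ∷ []
  insert-increasing x {y ∷ ys} (y≺ys ∷ inc) with compare x y
  ... | tri< x≺y _ _ = (x≺y ∷ All.map (≺-trans x≺y) y≺ys) ∷ y≺ys ∷ inc
  ... | tri≈ _ _ _   = y≺ys ∷ inc
  ... | tri> _ _ y≺x = All.tabulate (λ z∈ → [ (λ { refl → y≺x }) , All.lookup y≺ys ]′ (∈-insert⁻ x ys z∈))
                       ∷ insert-increasing x inc

  sort : List Ord → List Ord
  sort = foldr insert []

  sort-increasing : ∀ xs → Increasing (sort xs)
  sort-increasing []       = []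
  sort-increasing (x ∷ xs) = insert-increasing x (sort-increasing xs)

  ∈-sort⁺ : ∀ {xs} → xs ⊆ sort xs
  ∈-sort⁺ {x ∷ xs} (here refl) = ∈-insert⁺ˡ x (sort xs)
  ∈-sort⁺ {x ∷ xs} (there z∈)  = ∈-insert⁺ʳ x (sort xs) (∈-sort⁺ z∈)

  ∈-sort⁻ : ∀ {xs} → sort xs ⊆ xs
  ∈-sort⁻ {x ∷ xs} z∈ = [ here , there ∘ ∈-sort⁻ ]′ (∈-insert⁻ x (sort xs) z∈)

  ⊆-tails : ∀ {x xs ys} → Increasing (x ∷ xs) → x ∷ xs ⊆ x ∷ ys → xs ⊆ ys
  ⊆-tails (x≺xs ∷ _) sub z∈ with sub (there z∈)
  ... | here refl = contradiction (All.lookup x≺xs z∈) ≺-irrefl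
  ... | there z∈′ = z∈′

  -- If x ≢ y then x occurs in `ys`, so y ≺ x; hence y lies below every element of the first list
  -- and does not occur there.
  ⊆-skip : ∀ {x xs y ys} → Increasing (x ∷ xs) → Increasing (y ∷ ys) → x ≢ y →
           x ∷ xs ⊆ y ∷ ys → x ∷ xs ⊆ ys
  ⊆-skip (x≺xs ∷ _) (y≺ys ∷ _) x≢y sub z∈ with sub z∈
  ... | there z∈′ = z∈′
  ... | here refl with sub (here refl)
  ...   | here x≡y = contradiction x≡y x≢y
  ...   | there x∈ with z∈
  ...     | here y≡x  = contradiction (sym y≡x) x≢y
  ...     | there y∈  = contradiction (All.lookup x≺xs y∈) (≺-asym (All.lookup y≺ys x∈))

  length-⊆ : ∀ {xs ys} → Increasing xs → Increasing ys → xs ⊆ ys → length xs ≤ length ys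
  length-⊆ {[]}              _ _ _   = z≤n
  length-⊆ {x ∷ xs} {[]}     _ _ sub with () ← sub (here refl)
  length-⊆ {x ∷ xs} {y ∷ ys} inc@(_ ∷ xs↑) inc′@(_ ∷ ys↑) sub with x ≟ y
  ... | yes refl = s≤s (length-⊆ xs↑ ys↑ (⊆-tails inc sub))
  ... | no x≢y   = ℕ.m≤n⇒m≤1+n (length-⊆ inc ys↑ (⊆-skip inc inc′ x≢y sub))

  length-insert : ∀ x ys → x ∉ ys → length (insert x ys) ≡ suc (length ys)
  length-insert x []       _   = refl
  length-insert x (y ∷ ys) x∉ with compare x y
  ... | tri< _ _ _   = refl
  ... | tri≈ _ x≡y _ = contradiction (here x≡y) x∉
  ... | tri> _ _ _   = cong suc (length-insert x ys (x∉ ∘ there))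

  length-⊂ : ∀ {x xs ys} → Increasing xs → Increasing ys → xs ⊆ ys → x ∉ xs → x ∈ ys →
             length xs < length ys
  length-⊂ {x} {xs} inc inc′ sub x∉ x∈ =
    subst (_≤ _) (length-insert x xs x∉) (length-⊆ (insert-increasing x inc) inc′
      λ z∈ → [ (λ { refl → x∈ }) , sub ]′ (∈-insert⁻ x xs z∈))

  length-≡ : ∀ {xs ys} → Increasing xs → Increasing ys → xs ⊆ ys → ys ⊆ xs →
             length xs ≡ length ys
  length-≡ inc inc′ sub sub′ = ℕ.≤-antisym (length-⊆ inc inc′ sub) (length-⊆ inc′ inc sub′)

  abstract
    below : Ord → List Ord → List Ord
    below α = filter (_≺? α)

    below-increasing : ∀ α {F} → Increasing F → Increasing (below α F)
    below-increasing α = AllPairs.filter⁺ (_≺? α)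

    ∈-below⁺ : ∀ α F {ξ} → ξ ∈ F → ξ ≺ α → ξ ∈ below α F
    ∈-below⁺ α F = ∈-filter⁺ (_≺? α)

    ∈-below⁻ : ∀ α F {ξ} → ξ ∈ below α F → ξ ∈ F × ξ ≺ α
    ∈-below⁻ α F = ∈-filter⁻ (_≺? α) {xs = F}

    below-all : ∀ α F → All (_≺ α) F → below α F ≡ F
    below-all α F = List.filter-all (_≺? α)

    below-none : ∀ α F → All (λ ξ → ¬ (ξ ≺ α)) F → below α F ≡ []
    below-none α F = List.filter-none (_≺? α)

  index-least : ∀ {x xs} → Increasing (x ∷ xs) → (x∈ : x ∈ x ∷ xs) → toℕ (index x∈) ≡ 0
  index-least _ (here _) = refl
  index-least (x≺xs ∷ _) (there x∈) = contradiction (All.lookup x≺xs x∈) ≺-irrefl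

-- Positions of ordinals in a construction scheme

-- Meant for the parts of the tails below an element of the i-th tail: earlier tails count in full,
-- later ones not at all.
length-concat-tabulate : ∀ {A : Set} {n c} (T : Fin n → List A) (i : Fin n) →
  (∀ j → j Fin.< i → length (T j) ≡ c) → (∀ j → i Fin.< j → length (T j) ≡ 0) →
  length (concat (List.tabulate T)) ≡ toℕ i ℕ.* c ℕ.+ length (T i)
length-concat-tabulate {n = suc n} {c} T Fin.zero lo hi = begin
  length (T Fin.zero ++ concat (List.tabulate (T ∘ Fin.suc)))           ≡⟨ List.length-++ (T Fin.zero) ⟩
  length (T Fin.zero) ℕ.+ length (concat (List.tabulate (T ∘ Fin.suc))) ≡⟨ cong (length (T Fin.zero) ℕ.+_)
                                                                              (empty (T ∘ Fin.suc) λ j → hi (Fin.suc j) (s≤s z≤n)) ⟩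
  length (T Fin.zero) ℕ.+ 0                                             ≡⟨ ℕ.+-identityʳ _ ⟩
  length (T Fin.zero)                                                   ∎
  where
  open ≡-Reasoning
  empty : ∀ {A : Set} {n} (T : Fin n → List A) → (∀ j → length (T j) ≡ 0) →
          length (concat (List.tabulate T)) ≡ 0
  empty {n = zero}  T e = refl
  empty {n = suc n} T e = trans (List.length-++ (T Fin.zero))
    (cong₂ ℕ._+_ (e Fin.zero) (empty (T ∘ Fin.suc) (e ∘ Fin.suc)))
length-concat-tabulate {n = suc n} {c} T (Fin.suc i) lo hi = begin
  length (T Fin.zero ++ concat (List.tabulate (T ∘ Fin.suc)))           ≡⟨ List.length-++ (T Fin.zero) ⟩
  length (T Fin.zero) ℕ.+ length (concat (List.tabulate (T ∘ Fin.suc))) ≡⟨ cong₂ ℕ._+_ (lo Fin.zero (s≤s z≤n))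
                                                                              (length-concat-tabulate (T ∘ Fin.suc) i lo′ hi′) ⟩
  c ℕ.+ (toℕ i ℕ.* c ℕ.+ length (T (Fin.suc i)))                        ≡⟨ ℕ.+-assoc c _ _ ⟨
  c ℕ.+ toℕ i ℕ.* c ℕ.+ length (T (Fin.suc i))                          ∎
  where
  open ≡-Reasoning
  lo′ : ∀ j → j Fin.< i → length (T (Fin.suc j)) ≡ c
  lo′ j j<i = lo (Fin.suc j) (s≤s j<i)
  hi′ : ∀ j → i Fin.< j → length (T (Fin.suc j)) ≡ 0
  hi′ j i<j = hi (Fin.suc j) (s≤s i<j)

module SchemeTypes (τ : SchemeType) where
  open SchemeType τ

  1≤m∸r : ∀ k → 1 ≤ m k ∸ r (suc k)
  1≤m∸r k = ℕ.m<n⇒0<n∸m (r<m k)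

  r+[m∸r]≡m : ∀ k → r (suc k) ℕ.+ (m k ∸ r (suc k)) ≡ m k
  r+[m∸r]≡m k = ℕ.m+[n∸m]≡n (ℕ.<⇒≤ (r<m k))

  m<m-suc : ∀ k → m k < m (suc k)
  m<m-suc k = begin-strict
    m k                                     ≡⟨ r+[m∸r]≡m k ⟨
    r (suc k) ℕ.+ d                         <⟨ ℕ.+-monoʳ-< (r (suc k)) d<d*n ⟩
    r (suc k) ℕ.+ d ℕ.* n (suc k)           ≡⟨ m-suc k ⟨
    m (suc k)                               ∎
    where
    open ℕ.≤-Reasoning
    d = m k ∸ r (suc k)
    d<d*n : d < d ℕ.* n (suc k)
    d<d*n = ℕ.m<m*n d (n (suc k)) {{ℕ.>-nonZero (1≤m∸r k)}} (n≥2 k)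

  m-mono : ∀ {k l} → k ≤ l → m k ≤ m l
  m-mono k≤l = go (ℕ.≤⇒≤′ k≤l)
    where
    go : ∀ {k l} → k ℕ.≤′ l → m k ≤ m l
    go ℕ.≤′-refl       = ℕ.≤-refl
    go (ℕ.≤′-step k≤l) = ℕ.≤-trans (go k≤l) (ℕ.<⇒≤ (m<m-suc _))

module Positions (em : ∀ {ℓ} → ExcludedMiddle ℓ) (W : ω₁) (τ : SchemeType)
                 (𝓕 : Pred (List (ω₁.Ord W)) 0ℓ)
                 (scheme : Schemes.IsConstructionScheme W τ 𝓕) where
  open Ordinals W
  open SchemeType τ
  open SchemeTypes τ
  open IsConstructionScheme scheme hiding (increasing)
  open Classical em

  Level : ℕ → List Ord → Set
  Level = Level𝓕 τ 𝓕

  increasing : ∀ {k F} → Level k F → Increasing F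
  increasing (F∈ , _) = IsConstructionScheme.increasing scheme _ F∈

  -- Otherwise the index in `F` would number all of ω₁.
  fresh : ∀ F → ∃[ β ] β ∉ F
  fresh F = decidable-stable em λ none →
    let covered : ∀ β → β ∈ F
        covered β = decidable-stable em λ β∉ → none (β , β∉)
    in uncountable record
      { to        = λ β → toℕ (index (covered β))
      ; cong      = cong (λ β → toℕ (index (covered β)))
      ; injective = λ {α} {β} → index-injective (covered α) (covered β)
      }

  -- Each step adjoins an ordinal outside the current member and covers the result by cofinality.
  large : ∀ α b → ∃[ F ] (𝓕 F × α ∈ F × b ≤ length F)
  large α zero    =
    let F , F∈ , sub = cofinal (α ∷ []) ([] ∷ []) in F , F∈ , sub (here refl) , z≤n
  large α (suc b) =
    let F , F∈ , α∈ , b≤   = large α b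
        β , β∉             = fresh F
        F↑                 = IsConstructionScheme.increasing scheme F F∈
        G , G∈ , sub       = cofinal (insert β F) (insert-increasing β F↑)
        F⊆G                = λ {ξ} ξ∈ → sub (∈-insert⁺ʳ β F {ξ} ξ∈)
    in G , G∈ , F⊆G α∈ ,
       ℕ.≤-<-trans b≤ (length-⊂ F↑ (IsConstructionScheme.increasing scheme G G∈) F⊆G β∉ (sub (∈-insert⁺ˡ β F)))

  module _ {k F} (D : Decomposition τ 𝓕 k F) where
    open Decomposition D

    private
      another : (i : Fin (n (suc k))) → ∃[ j ] i ≢ j
      another i with n (suc k) | n≥2 k
      another Fin.zero    | suc zero    | s≤s ()
      another Fin.zero    | suc (suc _) | _ = Fin.suc Fin.zero , λ ()
      another (Fin.suc i) | suc (suc _) | _ = Fin.zero , λ ()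

    -- `IsΔSystem` relates the root only to pairs of distinct blocks; a second block exists as n (k
    -- + 1) ≥ 2.
    root⊆block : ∀ i → root ⊆ block i
    root⊆block i ξ∈ = let j , i≢j = another i in
      proj₁ (Equivalence.from (ΔSystem i j i≢j _) ξ∈)

    block⊆ : ∀ i → block i ⊆ F
    block⊆ i ξ∈ = Equivalence.from (union _) (i , ξ∈)

  descend : ∀ {k l F α} → k ℕ.≤′ l → Level l F → α ∈ F →
            ∃[ G ] (Level k G × α ∈ G × G ⊆ F)
  descend ℕ.≤′-refl F∈ α∈ = _ , F∈ , α∈ , id
  descend {l = suc l} {F} (ℕ.≤′-step k≤l) F∈ α∈ =
    let D                = decomposes l F F∈
        i , α∈i          = Equivalence.to (Decomposition.union D _) α∈
        G , G∈ , α∈G , G⊆ = descend k≤l (Decomposition.block∈𝓕 D i) α∈i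
    in G , G∈ , α∈G , block⊆ D i ∘ G⊆

  abstract
    -- A member with at least m k elements has level at least k, and the blocks containing `α` lead
    -- down from it to level k.
    cover : (α : Ord) (k : ℕ) → ∃[ F ] (Level k F × α ∈ F)
    cover α k =
      let F , F∈ , α∈ , m≤ = large α (m k)
          l , |F|≡         = sizes F F∈
          -- If l < k then `F` would have m l < m k elements.
          k≤l              = ℕ.≮⇒≥ λ l<k → ℕ.<-irrefl refl
                               (ℕ.<-≤-trans (ℕ.<-≤-trans (m<m-suc l) (m-mono l<k)) (subst (m k ≤_) |F|≡ m≤))
          G , G∈ , α∈G , _ = descend (ℕ.≤⇒≤′ k≤l) (F∈ , |F|≡) α∈
      in G , G∈ , α∈G

  below-coherent : ∀ {k E F α ξ} → Level k E → Level k F → α ∈ E → α ∈ F →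
                   ξ ∈ E → ξ ≺ α → ξ ∈ F
  below-coherent {k} {E} {F} E∈ F∈ α∈E α∈F ξ∈ ξ≺α =
    proj₂ (proj₂ (proj₁ (coherent k E F E∈ F∈)) _ _ (α∈E , α∈F) ξ∈ ξ≺α)

  rank : Ord → List Ord → ℕ
  rank α F = length (below α F)

  -- By coherence `α` has the same predecessors in both members; this frees `position` from the
  -- choice made in `cover`.
  rank-cong : ∀ {k E F α} → Level k E → Level k F → α ∈ E → α ∈ F → rank α E ≡ rank α F
  rank-cong {α = α} E∈ F∈ α∈E α∈F = length-≡
    (below-increasing α (increasing E∈)) (below-increasing α (increasing F∈))
    (half E∈ F∈ α∈E α∈F) (half F∈ E∈ α∈F α∈E)
    where
    half : ∀ {k E F} → Level k E → Level k F → α ∈ E → α ∈ F → below α E ⊆ below α F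
    half {E = E} {F} E∈ F∈ α∈E α∈F ξ∈ = let ξ∈E , ξ≺α = ∈-below⁻ α E ξ∈ in
      ∈-below⁺ α F (below-coherent E∈ F∈ α∈E α∈F ξ∈E ξ≺α) ξ≺α

  α∉below : ∀ α F → α ∉ below α F
  α∉below α F α∈ = ≺-irrefl (proj₂ (∈-below⁻ α F α∈))

  rank<length : ∀ {k F α} → Level k F → α ∈ F → rank α F < m k
  rank<length {k} {F} {α} F∈ α∈ = subst (rank α F <_) (proj₂ F∈)
    (length-⊂ (below-increasing α (increasing F∈)) (increasing F∈)
      (λ ξ∈ → proj₁ (∈-below⁻ α F ξ∈)) (α∉below α F) α∈)

  abstract
    position : (α : Ord) (k : ℕ) → Fin (m k)
    position α k = let F , F∈ , α∈ = cover α k in fromℕ< (rank<length F∈ α∈)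

    position≡rank : ∀ {k F α} → Level k F → α ∈ F → toℕ (position α k) ≡ rank α F
    position≡rank {k} {F} {α} F∈ α∈ = let G , G∈ , α∈G = cover α k in
      trans (Fin.toℕ-fromℕ< (rank<length G∈ α∈G)) (rank-cong G∈ F∈ α∈G α∈)

  -- In a member containing both, the predecessors of `α` are also predecessors of `β`, and so is
  -- `α` itself.
  position-< : ∀ {α β : Ord} → α ≺ β → ∃[ k ] position α k ≢ position β k
  position-< {α} {β} α≺β =
    let F , F∈ , sub = cofinal (α ∷ β ∷ []) ((α≺β ∷ []) ∷ [] ∷ [])
        k , |F|≡     = sizes F F∈
        α∈           = sub (here refl)
        β∈           = sub (there (here refl))
        F∈ₖ          = F∈ , |F|≡
        rank<        = length-⊂ (below-increasing α (increasing F∈ₖ)) (below-increasing β (increasing F∈ₖ))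
                         (λ ξ∈ → let ξ∈F , ξ≺α = ∈-below⁻ α F ξ∈ in ∈-below⁺ β F ξ∈F (≺-trans ξ≺α α≺β))
                         (α∉below α F) (∈-below⁺ β F α∈ α≺β)
    in k , λ e → ℕ.<⇒≢ rank< (trans (sym (position≡rank F∈ₖ α∈)) (trans (cong toℕ e) (position≡rank F∈ₖ β∈)))

  position-separates : ∀ {α β} → α ≢ β → ∃[ k ] position α k ≢ position β k
  position-separates {α} {β} α≢β with compare α β
  ... | tri< α≺β _ _ = position-< α≺β
  ... | tri≈ _ α≡β _ = contradiction α≡β α≢β
  ... | tri> _ _ β≺α = let k , ne = position-< β≺α in k , ne ∘ sym

  least : ∀ {P : ℕ → Set} b → P b → ∃[ k ] (IsLeast P k × k ≤ b)
  least {P} = <-rec (λ b → P b → ∃[ k ] (IsLeast P k × k ≤ b)) go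
    where
    go : ∀ b → (∀ {j} → j < b → P j → ∃[ k ] (IsLeast P k × k ≤ j)) → P b → ∃[ k ] (IsLeast P k × k ≤ b)
    go b smaller p with em {P = ∃[ j ] (j < b × P j)}
    ... | no none = b , (p , λ j pj → ℕ.≮⇒≥ λ j<b → none (j , j<b , pj)) , ℕ.≤-refl
    ... | yes (j , j<b , pj) = let k , isLeast , k≤j = smaller j<b pj in
      k , isLeast , ℕ.≤-trans k≤j (ℕ.<⇒≤ j<b)

  -- For ξ ≺ α, lying in `F` is the same as ρ(α,ξ) ≤ k: a witness of level j ≤ k coheres with a
  -- member of level j inside `F` that contains `α`. So positions are the norms that define Δ.
  position-norm : ∀ α k → IsNorm τ 𝓕 α k (toℕ (position α k))
  position-norm α k = let F , F∈ , α∈ = cover α k in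
    below α F , below-increasing α (increasing F∈) , sym (position≡rank F∈ α∈) ,
    λ ξ → mk⇔
      (λ ξ∈ → let ξ∈F , ξ≺α = ∈-below⁻ α F ξ∈
                  j , isρ , j≤k = least k (F , F∈ , α∈ , ξ∈F)
              in ξ≺α , j , isρ , j≤k)
      (λ (ξ≺α , j , ((G , G∈ , α∈G , ξ∈G) , _) , j≤k) →
        let H , H∈ , α∈H , H⊆F = descend (ℕ.≤⇒≤′ j≤k) F∈ α∈
        in ∈-below⁺ α F (H⊆F (below-coherent G∈ H∈ α∈G α∈H ξ∈G ξ≺α)) ξ≺α)

  -- Ξ_α(k + 1) = c and Ξ_α(k + 1) = -1 in terms of positions.
  record Branch (α : Ord) (k : ℕ) (c : Fin (n (suc k))) : Set where
    constructor branch
    field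
      beyond : r (suc k) ≤ toℕ (position α k)
      shift  : toℕ (position α (suc k)) ≡ toℕ c ℕ.* (m k ∸ r (suc k)) ℕ.+ toℕ (position α k)

  record Rooted (α : Ord) (k : ℕ) : Set where
    constructor rooted
    field
      inside : toℕ (position α k) < r (suc k)
      fixed  : toℕ (position α (suc k)) ≡ toℕ (position α k)

  -- Positions along the decomposition of a member

  module _ {k F} (F∈ : Level (suc k) F) (D : Decomposition τ 𝓕 k F) where
    open Decomposition D

    private
      tail : Fin (n (suc k)) → List Ord
      tail i = filter (λ ξ → ¬? (∈root? ξ)) (block i)
        where
        ∈root? : ∀ ξ → Dec (ξ ∈ root)
        ∈root? ξ = em

      ∈-tail⁺ : ∀ {i ξ} → ξ ∈ block i → ξ ∉ root → ξ ∈ tail i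
      ∈-tail⁺ = ∈-filter⁺ _

      ∈-tail⁻ : ∀ {i ξ} → ξ ∈ tail i → ξ ∈ block i × ξ ∉ root
      ∈-tail⁻ {i} = ∈-filter⁻ _ {xs = block i}

      tail↑ : ∀ i → Increasing (tail i)
      tail↑ i = AllPairs.filter⁺ _ (increasing (block∈𝓕 i))

      length-root-block : ∀ i {α} → α ∈ tail i → rank α (block i) ≡ r (suc k) ℕ.+ rank α (tail i)
      length-root-block i {α} α∈ = begin
        rank α (block i)                    ≡⟨ length-≡ (below-increasing α (increasing (block∈𝓕 i))) joined↑ ⊆₁ ⊆₂ ⟩
        length (root ++ below α (tail i))   ≡⟨ List.length-++ root ⟩
        length root ℕ.+ rank α (tail i)     ≡⟨ cong (ℕ._+ rank α (tail i)) root-size ⟩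
        r (suc k) ℕ.+ rank α (tail i)       ∎
        where
        open ≡-Reasoning
        joined↑ : Increasing (root ++ below α (tail i))
        joined↑ = AllPairs.++⁺ root-increasing (below-increasing α (tail↑ i))
          (All.tabulate λ x∈ → All.tabulate λ y∈ → root≪tails i _ _ x∈ (∈-tail⁻ {i} (proj₁ (∈-below⁻ α (tail i) y∈))))
        ⊆₁ : below α (block i) ⊆ root ++ below α (tail i)
        ⊆₁ {ξ} ξ∈ with ξ∈b , ξ≺α ← ∈-below⁻ α (block i) ξ∈ | em {P = ξ ∈ root}
        ... | yes ξ∈r = ∈-++⁺ˡ ξ∈r
        ... | no ξ∉r  = ∈-++⁺ʳ root (∈-below⁺ α (tail i) (∈-tail⁺ {i} ξ∈b ξ∉r) ξ≺α)
        ⊆₂ : root ++ below α (tail i) ⊆ below α (block i)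
        ⊆₂ ξ∈ with ∈-++⁻ root ξ∈
        ... | inj₁ ξ∈r = ∈-below⁺ α (block i) (root⊆block D i ξ∈r) (root≪tails i _ _ ξ∈r (∈-tail⁻ {i} α∈))
        ... | inj₂ ξ∈t = let ξ∈t , ξ≺α = ∈-below⁻ α (tail i) ξ∈t in ∈-below⁺ α (block i) (proj₁ (∈-tail⁻ {i} ξ∈t)) ξ≺α

      length-tail : ∀ i → length (tail i) ≡ m k ∸ r (suc k)
      length-tail i = begin
        length (tail i)                               ≡⟨ ℕ.m+n∸m≡n (r (suc k)) _ ⟨
        r (suc k) ℕ.+ length (tail i) ∸ r (suc k)     ≡⟨ cong (λ t → t ℕ.+ length (tail i) ∸ r (suc k)) root-size ⟨
        length root ℕ.+ length (tail i) ∸ r (suc k)   ≡⟨ cong (_∸ r (suc k)) (List.length-++ root) ⟨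
        length (root ++ tail i) ∸ r (suc k)           ≡⟨ cong (_∸ r (suc k))
                                                            (length-≡ joined↑ (increasing (block∈𝓕 i)) ⊆₂ ⊆₁) ⟩
        length (block i) ∸ r (suc k)                  ≡⟨ cong (_∸ r (suc k)) (proj₂ (block∈𝓕 i)) ⟩
        m k ∸ r (suc k)                               ∎
        where
        open ≡-Reasoning
        joined↑ : Increasing (root ++ tail i)
        joined↑ = AllPairs.++⁺ root-increasing (tail↑ i)
          (All.tabulate λ x∈ → All.tabulate λ y∈ → root≪tails i _ _ x∈ (∈-tail⁻ {i} y∈))
        ⊆₁ : block i ⊆ root ++ tail i
        ⊆₁ {ξ} ξ∈ with em {P = ξ ∈ root}
        ... | yes ξ∈r = ∈-++⁺ˡ ξ∈r
        ... | no ξ∉r  = ∈-++⁺ʳ root (∈-tail⁺ {i} ξ∈ ξ∉r)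
        ⊆₂ : root ++ tail i ⊆ block i
        ⊆₂ ξ∈ with ∈-++⁻ root ξ∈
        ... | inj₁ ξ∈r = root⊆block D i ξ∈r
        ... | inj₂ ξ∈t = proj₁ (∈-tail⁻ {i} ξ∈t)

      -- Below `α` lie the root, the complete tails before the i-th, and the part of the i-th tail
      -- below `α`.
      rank-tail : ∀ i {α} → α ∈ tail i →
        rank α F ≡ r (suc k) ℕ.+ (toℕ i ℕ.* (m k ∸ r (suc k)) ℕ.+ rank α (tail i))
      rank-tail i {α} α∈ = begin
        rank α F                       ≡⟨ length-≡ (below-increasing α (increasing F∈)) joined↑ ⊆₁ ⊆₂ ⟩
        length (root ++ concat (List.tabulate earlier-part))   ≡⟨ List.length-++ root ⟩
        length root ℕ.+ length (concat (List.tabulate earlier-part))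
          ≡⟨ cong₂ ℕ._+_ root-size (length-concat-tabulate earlier-part i lo hi) ⟩
        r (suc k) ℕ.+ (toℕ i ℕ.* (m k ∸ r (suc k)) ℕ.+ rank α (tail i)) ∎
        where
        open ≡-Reasoning
        earlier-part : Fin (n (suc k)) → List Ord
        earlier-part j = below α (tail j)
        lo : ∀ j → j Fin.< i → length (earlier-part j) ≡ m k ∸ r (suc k)
        lo j j<i = trans (cong length (below-all α (tail j)
          (All.tabulate λ ξ∈ → tails≪tails j i j<i _ _ (∈-tail⁻ {j} ξ∈) (∈-tail⁻ {i} α∈)))) (length-tail j)
        hi : ∀ j → i Fin.< j → length (earlier-part j) ≡ 0
        hi j i<j = cong length (below-none α (tail j)
          (All.tabulate λ ξ∈ ξ≺α → ≺-asym ξ≺α (tails≪tails i j i<j _ _ (∈-tail⁻ {i} α∈) (∈-tail⁻ {j} ξ∈))))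
        ∈-earlier-part⁻ : ∀ {j ξ} → ξ ∈ earlier-part j → ξ ∈ tail j × ξ ≺ α
        ∈-earlier-part⁻ {j} = ∈-below⁻ α (tail j)
        concat⁻ : ∀ {ξ} → ξ ∈ concat (List.tabulate earlier-part) → ∃[ j ] ξ ∈ earlier-part j
        concat⁻ ξ∈ with ∈-concat⁻′ (List.tabulate earlier-part) ξ∈
        ... | xs , ξ∈xs , xs∈ with ∈-tabulate⁻ {f = earlier-part} xs∈
        ...   | j , refl = j , ξ∈xs
        joined↑ : Increasing (root ++ concat (List.tabulate earlier-part))
        joined↑ = AllPairs.++⁺ root-increasing
          (AllPairs.concat⁺ (All.tabulate⁺ λ j → below-increasing α (tail↑ j))
            (AllPairs.tabulate⁺-< λ {j} {l} j<l → All.tabulate λ x∈ → All.tabulate λ y∈ →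
              tails≪tails j l j<l _ _ (∈-tail⁻ {j} (proj₁ (∈-earlier-part⁻ {j} x∈)))
                (∈-tail⁻ {l} (proj₁ (∈-earlier-part⁻ {l} y∈)))))
          (All.tabulate λ x∈ → All.tabulate λ y∈ → let j , y∈j = concat⁻ y∈ in
            root≪tails j _ _ x∈ (∈-tail⁻ {j} (proj₁ (∈-earlier-part⁻ {j} y∈j))))
        ⊆₁ : below α F ⊆ root ++ concat (List.tabulate earlier-part)
        ⊆₁ {ξ} ξ∈ with ξ∈F , ξ≺α ← ∈-below⁻ α F ξ∈ | em {P = ξ ∈ root}
        ... | yes ξ∈r = ∈-++⁺ˡ ξ∈r
        ... | no ξ∉r  = let j , ξ∈j = Equivalence.to (union ξ) ξ∈F in
          ∈-++⁺ʳ root (∈-concat⁺′ (∈-below⁺ α (tail j) (∈-tail⁺ {j} ξ∈j ξ∉r) ξ≺α) (∈-tabulate⁺ {f = earlier-part} j))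
        ⊆₂ : root ++ concat (List.tabulate earlier-part) ⊆ below α F
        ⊆₂ ξ∈ with ∈-++⁻ root ξ∈
        ... | inj₁ ξ∈r = ∈-below⁺ α F (block⊆ D i (root⊆block D i ξ∈r)) (root≪tails i _ _ ξ∈r (∈-tail⁻ {i} α∈))
        ... | inj₂ ξ∈c = let j , ξ∈j = concat⁻ ξ∈c
                             ξ∈t , ξ≺α = ∈-earlier-part⁻ {j} ξ∈j
                         in ∈-below⁺ α F (block⊆ D j (proj₁ (∈-tail⁻ {j} ξ∈t))) ξ≺α

    tail⇒Branch : ∀ i {α} → α ∈ block i → α ∉ root → Branch α k i
    tail⇒Branch i {α} α∈i α∉r = branch (subst (r (suc k) ≤_) (sym low) (ℕ.m≤m+n _ _)) (begin
      toℕ (position α (suc k))                 ≡⟨ position≡rank F∈ (block⊆ D i α∈i) ⟩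
      rank α F                                 ≡⟨ rank-tail i α∈t ⟩
      r (suc k) ℕ.+ (c ℕ.+ rank α (tail i))    ≡⟨ ℕ.+-assoc (r (suc k)) c _ ⟨
      r (suc k) ℕ.+ c ℕ.+ rank α (tail i)      ≡⟨ cong (ℕ._+ rank α (tail i)) (ℕ.+-comm (r (suc k)) c) ⟩
      c ℕ.+ r (suc k) ℕ.+ rank α (tail i)      ≡⟨ ℕ.+-assoc c (r (suc k)) _ ⟩
      c ℕ.+ (r (suc k) ℕ.+ rank α (tail i))    ≡⟨ cong (c ℕ.+_) low ⟨
      c ℕ.+ toℕ (position α k)                 ∎)
      where
      open ≡-Reasoning
      α∈t = ∈-tail⁺ {i} α∈i α∉r
      c = toℕ i ℕ.* (m k ∸ r (suc k))
      low : toℕ (position α k) ≡ r (suc k) ℕ.+ rank α (tail i)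
      low = trans (position≡rank (block∈𝓕 i) α∈i) (length-root-block i α∈t)

    -- The root precedes all tails, so whatever lies below `α` is in the root, and hence in every
    -- block.
    root⇒Rooted : ∀ i {α} → α ∈ block i → α ∈ root → Rooted α k
    root⇒Rooted i {α} α∈i α∈r = rooted
      (subst (_< r (suc k)) (sym (position≡rank (block∈𝓕 i) α∈i))
        (subst (rank α (block i) <_) root-size
          (length-⊂ (below-increasing α (increasing (block∈𝓕 i))) root-increasing ⊆root
            (α∉below α (block i)) α∈r)))
      (trans (position≡rank F∈ (block⊆ D i α∈i))
        (trans (length-≡ (below-increasing α (increasing F∈)) (below-increasing α (increasing (block∈𝓕 i))) ⊆₁ ⊆₂)
          (sym (position≡rank (block∈𝓕 i) α∈i))))
      where
      earlier : ∀ {j ξ} → ξ ∈ block j → ξ ≺ α → ξ ∈ root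
      earlier {j} ξ∈ ξ≺α = decidable-stable em λ ξ∉r →
        ≺-asym ξ≺α (root≪tails j _ _ α∈r (ξ∈ , ξ∉r))
      ⊆root : below α (block i) ⊆ root
      ⊆root ξ∈ = let ξ∈b , ξ≺α = ∈-below⁻ α (block i) ξ∈ in earlier {i} ξ∈b ξ≺α
      ⊆₁ : below α F ⊆ below α (block i)
      ⊆₁ ξ∈ = let ξ∈F , ξ≺α = ∈-below⁻ α F ξ∈
                  j , ξ∈j = Equivalence.to (union _) ξ∈F
              in ∈-below⁺ α (block i) (root⊆block D i (earlier {j} ξ∈j ξ≺α)) ξ≺α
      ⊆₂ : below α (block i) ⊆ below α F
      ⊆₂ ξ∈ = let ξ∈b , ξ≺α = ∈-below⁻ α (block i) ξ∈ in ∈-below⁺ α F (block⊆ D i ξ∈b) ξ≺α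

  -- The tree of positions

  step : ∀ α k → Rooted α k ⊎ (∃[ c ] Branch α k c)
  step α k with cover α (suc k)
  ... | F , F∈ , α∈ with decomposes k F F∈
  ...   | D with Equivalence.to (Decomposition.union D α) α∈ | em {P = α ∈ Decomposition.root D}
  ...     | i , α∈i | yes α∈r = inj₁ (root⇒Rooted F∈ D i α∈i α∈r)
  ...     | i , α∈i | no α∉r  = inj₂ (i , tail⇒Branch F∈ D i α∈i α∉r)

  -- `IsΞ` brings its own decomposition; positions forget it, so the result can be compared with
  -- that of `step`.
  Ξ⇒Branch : ∀ {α k} c → IsΞ τ 𝓕 α (suc k) (+ toℕ c) → Branch α k c
  Ξ⇒Branch {α} {k} c isΞ = go isΞ refl
    where
    go : ∀ {v} → IsΞ τ 𝓕 α (suc k) v → v ≡ + toℕ c → Branch α k c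
    go (Ξ-root _ _ _) ()
    go (Ξ-tail F∈ D i (α∈i , α∉r)) e with Fin.toℕ-injective (+-injective e)
      where
      +-injective : ∀ {a b} → + a ≡ + b → a ≡ b
      +-injective refl = refl
    ... | refl = tail⇒Branch F∈ D i α∈i α∉r

  Rooted⇒¬Branch : ∀ {α β k c} → position α k ≡ position β k → Rooted α k → ¬ Branch β k c
  Rooted⇒¬Branch e (rooted p<r _) (branch r≤q _) = ℕ.<⇒≱ p<r (subst (_ ≤_) (sym (cong toℕ e)) r≤q)

  -- With w = m k ∸ r (k + 1), the c-th tail occupies the positions from c w + r up to c w + m k =
  -- (c + 1) w + r, which is where the next tail starts.
  branch-< : ∀ {α β k c d} → Branch α k c → Branch β k d → c Fin.< d →
             position α (suc k) ≢ position β (suc k)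
  branch-< {α} {β} {k} {c} {d} (branch _ p≡) (branch r≤q q≡) c<d e = ℕ.<⇒≢ p′<q′ (cong toℕ e)
    where
    w = m k ∸ r (suc k)
    p′<q′ : toℕ (position α (suc k)) < toℕ (position β (suc k))
    p′<q′ = begin-strict
      toℕ (position α (suc k))                 ≡⟨ p≡ ⟩
      toℕ c ℕ.* w ℕ.+ toℕ (position α k)       <⟨ ℕ.+-monoʳ-< (toℕ c ℕ.* w) (Fin.toℕ<n (position α k)) ⟩
      toℕ c ℕ.* w ℕ.+ m k                      ≡⟨ cong (toℕ c ℕ.* w ℕ.+_)
                                                     (trans (sym (r+[m∸r]≡m k)) (ℕ.+-comm (r (suc k)) w)) ⟩
      toℕ c ℕ.* w ℕ.+ (w ℕ.+ r (suc k))        ≡⟨ ℕ.+-assoc (toℕ c ℕ.* w) w _ ⟨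
      toℕ c ℕ.* w ℕ.+ w ℕ.+ r (suc k)          ≡⟨ cong (ℕ._+ r (suc k)) (ℕ.+-comm (toℕ c ℕ.* w) w) ⟩
      suc (toℕ c) ℕ.* w ℕ.+ r (suc k)          ≤⟨ ℕ.+-mono-≤ (ℕ.*-monoˡ-≤ w c<d) r≤q ⟩
      toℕ d ℕ.* w ℕ.+ toℕ (position β k)       ≡⟨ q≡ ⟨
      toℕ (position β (suc k))                 ∎
      where open ℕ.≤-Reasoning

  branch-unique : ∀ {α β k c d} → Branch α k c → Branch β k d →
                  position α (suc k) ≡ position β (suc k) → c ≡ d
  branch-unique {c = c} {d} b b′ e with Fin.<-cmp c d
  ... | tri< c<d _ _ = contradiction e (branch-< b b′ c<d)
  ... | tri≈ _ c≡d _ = c≡d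
  ... | tri> _ _ d<c = contradiction (sym e) (branch-< b′ b d<c)

  branch-position : ∀ {α β k c} → Branch α k c → Branch β k c →
                    position α k ≡ position β k → position α (suc k) ≡ position β (suc k)
  branch-position (branch _ p≡) (branch _ q≡) e =
    Fin.toℕ-injective (trans p≡ (trans (cong (λ p → _ ℕ.+ toℕ p) e) (sym q≡)))

  rooted-position : ∀ {α β k} → Rooted α k → Rooted β k →
                    position α k ≡ position β k → position α (suc k) ≡ position β (suc k)
  rooted-position (rooted _ p≡) (rooted _ q≡) e = Fin.toℕ-injective (trans p≡ (trans (cong toℕ e) (sym q≡)))

  -- Root positions stay below r and tail positions at or above r, so the cases do not mix; in a
  -- tail the child number is determined and its shift cancels.
  position-pred : ∀ {α β} k → position α (suc k) ≡ position β (suc k) → position α k ≡ position β k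
  position-pred {α} {β} k e with step α k | step β k
  ... | inj₁ (rooted _ p≡) | inj₁ (rooted _ q≡) = Fin.toℕ-injective (trans (sym p≡) (trans (cong toℕ e) q≡))
  ... | inj₁ (rooted p<r p≡) | inj₂ (c , branch r≤q q≡) = contradiction (cong toℕ e)
    (ℕ.<⇒≢ (ℕ.<-≤-trans (subst (_< _) (sym p≡) p<r) (subst (_ ≤_) (sym q≡) (ℕ.m≤n⇒m≤o+n _ r≤q))))
  ... | inj₂ (c , branch r≤q q≡) | inj₁ (rooted p<r p≡) = contradiction (cong toℕ (sym e))
    (ℕ.<⇒≢ (ℕ.<-≤-trans (subst (_< _) (sym p≡) p<r) (subst (_ ≤_) (sym q≡) (ℕ.m≤n⇒m≤o+n _ r≤q))))
  ... | inj₂ (c , b@(branch _ p≡)) | inj₂ (d , b′@(branch _ q≡)) with branch-unique b b′ e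
  ...   | refl = Fin.toℕ-injective (ℕ.+-cancelˡ-≡ _ _ _ (trans (sym p≡) (trans (cong toℕ e) q≡)))

  position-lower : ∀ {α β k l} → k ≤ l → position α l ≡ position β l → position α k ≡ position β k
  position-lower k≤l = go (ℕ.≤⇒≤′ k≤l)
    where
    go : ∀ {α β k l} → k ℕ.≤′ l → position α l ≡ position β l → position α k ≡ position β k
    go ℕ.≤′-refl       e = e
    go (ℕ.≤′-step k≤l) e = go k≤l (position-pred _ e)

  position-zero : ∀ α β → position α 0 ≡ position β 0
  position-zero α β = Fin.toℕ-injective (trans (zero≡ (position α 0)) (sym (zero≡ (position β 0))))
    where
    zero≡ : (p : Fin (m 0)) → toℕ p ≡ 0
    zero≡ p = ℕ.n<1⇒n≡0 (subst (toℕ p <_) m-zero (Fin.toℕ<n p))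

  -- Descend from a separating height; the search stops because all positions agree at height 0,
  -- where m 0 = 1.
  splitting : ∀ {α β} → α ≢ β → ∃[ k ] (position α k ≡ position β k × position α (suc k) ≢ position β (suc k))
  splitting {α} {β} α≢β = let l , ne = position-separates α≢β in go l ne
    where
    go : ∀ l → position α l ≢ position β l → _
    go zero    ne = contradiction (position-zero α β) ne
    go (suc l) ne with position α l Fin.≟ position β l
    ... | yes e  = l , e , ne
    ... | no ne′ = go l ne′

  splitting-branches : ∀ {α β k} → position α k ≡ position β k → position α (suc k) ≢ position β (suc k) →
    ∃₂ λ c d → Branch α k c × Branch β k d × c ≢ d
  splitting-branches {α} {β} {k} e ne with step α k | step β k
  ... | inj₁ p | inj₁ q = contradiction (rooted-position p q e) ne
  ... | inj₁ p | inj₂ (_ , b) = contradiction b (Rooted⇒¬Branch e p)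
  ... | inj₂ (_ , b) | inj₁ q = contradiction b (Rooted⇒¬Branch (sym e) q)
  ... | inj₂ (c , b) | inj₂ (d , b′) = c , d , b , b′ , λ { refl → ne (branch-position b b′ e) }

  -- Positions are norms, so a difference at height l would contradict the minimality of l + 1.
  Δ⇒position : ∀ {α β l} → IsΔ τ 𝓕 α β (suc l) → position α l ≡ position β l
  Δ⇒position {α} {β} {l} (_ , minimal) with position α l Fin.≟ position β l
  ... | yes e = e
  ... | no ne = contradiction (minimal l (_ , _ , position-norm α l , position-norm β l , ne ∘ Fin.toℕ-injective))
                              (ℕ.<⇒≱ ℕ.≤-refl)

-- Sign patterns

pattern 0F = Fin.zero
pattern 1F = Fin.suc Fin.zero

reverse-if : ∀ {m} → Fin 2 → Fin m → Fin m
reverse-if 0F i = i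
reverse-if 1F i = opposite i

opposite-injective : ∀ {m} {i j : Fin m} → opposite i ≡ opposite j → i ≡ j
opposite-injective {i = i} {j} e =
  trans (sym (Fin.opposite-involutive i)) (trans (cong opposite e) (Fin.opposite-involutive j))

reverse-if-injective : ∀ {m} b {i j : Fin m} → reverse-if b i ≡ reverse-if b j → i ≡ j
reverse-if-injective 0F e = e
reverse-if-injective 1F e = opposite-injective e

reverse-if-twice : ∀ {m} b (i : Fin m) → reverse-if b (reverse-if b i) ≡ i
reverse-if-twice 0F i = refl
reverse-if-twice 1F i = Fin.opposite-involutive i

opposite-anti : ∀ {m} {i j : Fin m} → i Fin.< j → opposite j Fin.< opposite i
opposite-anti {m} {i} {j} i<j rewrite Fin.opposite-prop i | Fin.opposite-prop j =
  ℕ.∸-monoʳ-< (s≤s i<j) (Fin.toℕ<n j)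

opposite≢ : (b : Fin 2) → opposite b ≢ b
opposite≢ 0F ()
opposite≢ 1F ()

≢⇒opposite : {a b : Fin 2} → a ≢ b → a ≡ opposite b
≢⇒opposite {0F} {0F} ne = contradiction refl ne
≢⇒opposite {0F} {1F} ne = refl
≢⇒opposite {1F} {0F} ne = refl
≢⇒opposite {1F} {1F} ne = contradiction refl ne

-- The clause `1 ≤ N` excludes the single entry at 0, which would always be constant, and so
-- switches off the twist for `N = 0`.
Constant : ℕ → (ℕ → Fin 2) → Set
Constant N f = 1 ≤ N × (∀ {i} → i < N → f (suc i) ≡ f 0)

constant? : ∀ N f → Dec (Constant N f)
constant? N f = (1 ℕ.≤? N) ×-dec ℕ.allUpTo? (λ i → f (suc i) Fin.≟ f 0) N

-- For N ≥ 1 the entry at 0 is the one sacrificed to make the entries at 0, …, N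
-- non-constant; twist 0 is the identity.
twist : ℕ → (ℕ → Fin 2) → ℕ → Fin 2
twist N f zero with constant? N f
... | yes _ = opposite (f 0)
... | no _  = f 0
twist N f (suc i) = f (suc i)

twist-¬constant : ∀ {N f} → ¬ Constant N f → ∀ i → twist N f i ≡ f i
twist-¬constant {N} {f} nc zero with constant? N f
... | yes c = contradiction c nc
... | no _  = refl
twist-¬constant nc (suc i) = refl

-- The entries at 0, ..., N decide `Constant`; the entry at `i`, possibly beyond `N`, is the one
-- returned or flipped.
twist-cong : ∀ {N f g i} → (∀ j → j ≤ N → f j ≡ g j) → f i ≡ g i → twist N f i ≡ twist N g i
twist-cong {N} {f} {g} {zero} f≗g e with constant? N f | constant? N g
... | yes _ | yes _ = cong opposite e
... | no _  | no _  = e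
... | yes (1≤N , c) | no nc =
  contradiction (1≤N , λ {_} i<N → trans (sym (f≗g _ i<N)) (trans (c i<N) (f≗g 0 z≤n))) nc
... | no nc | yes (1≤N , c) =
  contradiction (1≤N , λ {_} i<N → trans (f≗g _ i<N) (trans (c i<N) (sym (f≗g 0 z≤n)))) nc
twist-cong {i = suc i} f≗g e = e

-- If `b` is missing at 1, ..., N, these entries all equal `opposite b`. Then the entry at 0 either
-- equals them and is flipped to `b`, or differs from them and is already `b`.
twist-both : ∀ {N} f → 1 ≤ N → ∀ b → ∃[ i ] (i ≤ N × twist N f i ≡ b)
twist-both {N} f 1≤N b with ℕ.anyUpTo? (λ i → f (suc i) Fin.≟ b) N
... | yes (i , i<N , e) = suc i , i<N , e
... | no none = 0 , z≤n , twist₀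
  where
  rest : ∀ {i} → i < N → f (suc i) ≡ opposite b
  rest i<N = ≢⇒opposite λ e → none (_ , i<N , e)
  twist₀ : twist N f 0 ≡ b
  twist₀ with constant? N f
  ... | yes (_ , c) = trans (cong opposite (trans (sym (c 1≤N)) (rest 1≤N))) (Fin.opposite-involutive b)
  ... | no nc = decidable-stable (f 0 Fin.≟ b) λ ne →
    nc (1≤N , λ i<N → trans (rest i<N) (sym (≢⇒opposite ne)))

module _ {k} {P : Set} (_≟_ : (p q : P) → Dec (p ≡ q)) (p : Fin k → P) (i : Fin k → ℕ) (b : Fin k → Fin 2) where

  private
    Prescribed : P → ℕ → Set
    Prescribed q j = ∃[ t ] (p t ≡ q × i t ≡ j)

    prescribed? : ∀ q j → Dec (Prescribed q j)
    prescribed? q j = Fin.any? λ t → (p t ≟ q) ×-dec (i t ℕ.≟ j)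

  -- The default avoids Constant unless all of the entries at 0, …, N are prescribed.
  fill : P → ℕ → Fin 2
  fill q zero with prescribed? q 0
  ... | yes (t , _) = b t
  ... | no _        = 0F
  fill q (suc j) with prescribed? q (suc j)
  ... | yes (t , _) = b t
  ... | no _        = opposite (fill q 0)

  module _ (distinct : ∀ {s t} → p s ≡ p t → i s ≡ i t → s ≡ t) where

    fill-prescribed : ∀ t → fill (p t) (i t) ≡ b t
    fill-prescribed t = go (i t) refl
      where
      go : ∀ j → i t ≡ j → fill (p t) j ≡ b t
      go zero e with prescribed? (p t) 0
      ... | yes (s , e₁ , e₂) = cong b (distinct e₁ (trans e₂ (sym e)))
      ... | no none           = contradiction (t , refl , e) none
      go (suc j) e with prescribed? (p t) (suc j)
      ... | yes (s , e₁ , e₂) = cong b (distinct e₁ (trans e₂ (sym e)))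
      ... | no none           = contradiction (t , refl , e) none

    -- An entry that is not prescribed differs from the one at 0, so in a constant row all N + 1
    -- entries would be prescribed, by only k ≤ N indices.
    fill-¬constant : ∀ {N} t → i t ≡ 0 → N ≡ 0 ⊎ k ≤ N → ¬ Constant N (fill (p t))
    fill-¬constant t e (inj₁ refl) (() , _)
    fill-¬constant {N} t e (inj₂ k≤N) (_ , c) =
      let s , s′ , s<s′ , same = Fin.pigeonhole (s≤s k≤N) (proj₁ ∘ witness)
      in ℕ.<⇒≢ s<s′ (trans (sym (proj₂ (proj₂ (witness s)))) (trans (cong i same) (proj₂ (proj₂ (witness s′)))))
      where
      witness : (s : Fin (suc N)) → Prescribed (p t) (toℕ s)
      witness 0F = t , refl , e
      witness (Fin.suc s) with prescribed? (p t) (suc (toℕ s)) | c (Fin.toℕ<n s)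
      ... | yes w | _ = w
      ... | no _  | same = contradiction same (opposite≢ _)

    -- `twist` can change only the entry at 0, and if that one is prescribed then the row is not
    -- constant.
    twist-fill : ∀ {N} → N ≡ 0 ⊎ k ≤ N → ∀ t → twist N (fill (p t)) (i t) ≡ b t
    twist-fill {N} small t = trans (unchanged (i t) refl) (fill-prescribed t)
      where
      unchanged : ∀ j → i t ≡ j → twist N (fill (p t)) j ≡ fill (p t) j
      unchanged zero    e = twist-¬constant (fill-¬constant t e small) zero
      unchanged (suc j) e = refl

orientation : ℕ → Fin 2
orientation zero    = 0F
orientation (suc _) = 1F

-- The orderings of the children of a node

module _ {M l : ℕ} where

  -- A matrix of signs with M rows and l columns, coded as a number so that patterns are linearly
  -- ordered.
  Pattern : Set
  Pattern = Fin (2 ℕ.^ (M ℕ.* l))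

  entry : Pattern → Fin M → ℕ → Fin 2
  entry s p i with i ℕ.<? l
  ... | yes i<l = finToFun s (combine p (fromℕ< i<l))
  -- Columns outside the matrix are read as `0F`. At low heights `twist` does read them;
  -- `childRank-clash` holds there as well.
  ... | no _    = 0F

  pattern-with : (Fin M → ℕ → Fin 2) → Pattern
  pattern-with f = funToFin λ x → let p , i = remQuot {M} l x in f p (toℕ i)

  entry-pattern-with : ∀ f p {i} → i < l → entry (pattern-with f) p i ≡ f p i
  entry-pattern-with f p {i} i<l with i ℕ.<? l
  ... | no i≮l = contradiction i<l i≮l
  ... | yes i<l = trans (Fin.finToFun-funToFin _ (combine p (fromℕ< i<l)))
    (trans (cong (λ (q , j) → f q (toℕ j)) (Fin.remQuot-combine p (fromℕ< i<l)))
           (cong (f p) (Fin.toℕ-fromℕ< i<l)))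

  module _ (N : ℕ) (p : Fin M) (i : ℕ) where

    permute : Fin (2 ℕ.^ (M ℕ.* l) ℕ.* 2) → Fin (2 ℕ.^ (M ℕ.* l) ℕ.* 2)
    permute c = let s , ε = remQuot 2 c in
      combine (reverse-if (orientation i) s) (reverse-if (twist N (entry s p) i) ε)

    -- The order of the children at node `p` in copy `i`, given as a rank so that it can be an entry
    -- of a sequence; `combine` makes the pattern the leading digit.
    childRank : Fin (2 ℕ.^ (M ℕ.* l) ℕ.* 2) → ℕ
    childRank c = toℕ (permute c)

    permute-combine : ∀ s ε → permute (combine s ε) ≡
      combine (reverse-if (orientation i) s) (reverse-if (twist N (entry s p) i) ε)
    permute-combine s ε = cong
      (λ (s , ε) → combine (reverse-if (orientation i) s) (reverse-if (twist N (entry s p) i) ε))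
      (Fin.remQuot-combine s ε)

    -- The pattern is recovered first, and it determines whether the last digit was reversed.
    childRank-injective : ∀ {c d} → childRank c ≡ childRank d → c ≡ d
    childRank-injective {c} {d} e
      with s , ε , refl ← Fin.combine-surjective {2 ℕ.^ (M ℕ.* l)} {2} c
         | t , δ , refl ← Fin.combine-surjective {2 ℕ.^ (M ℕ.* l)} {2} d
      = let e₁ , e₂ = Fin.combine-injective (reverse-if (orientation i) s) (reverse-if (twist N (entry s p) i) ε)
                        (reverse-if (orientation i) t) (reverse-if (twist N (entry t p) i) δ)
                        (trans (sym (permute-combine s ε)) (trans (Fin.toℕ-injective e) (permute-combine t δ)))
        in same (reverse-if-injective (orientation i) {s} {t} e₁) e₂
      where
      same : ∀ {s t ε δ} → s ≡ t →
        reverse-if (twist N (entry s p) i) ε ≡ reverse-if (twist N (entry t p) i) δ →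
        combine s ε ≡ combine t δ
      same {s} refl e₂ = cong (combine s) (reverse-if-injective (twist N (entry s p) i) e₂)

    -- Reversing twice by `b` restores the last digit, so the two ranks end in 0 and 1.
    childRank-twist : ∀ s {b} → twist N (entry s p) i ≡ b →
      childRank (combine s (reverse-if b 0F)) < childRank (combine s (reverse-if b 1F))
    childRank-twist s {b} e =
      subst₂ _<_ (sym (value 0F)) (sym (value 1F)) (ℕ.+-monoʳ-< (2 ℕ.* toℕ (reverse-if (orientation i) s)) (s≤s z≤n))
      where
      value : ∀ ε → childRank (combine s (reverse-if b ε)) ≡ 2 ℕ.* toℕ (reverse-if (orientation i) s) ℕ.+ toℕ ε
      value ε = trans (cong toℕ (permute-combine s (reverse-if b ε)))
        (trans (Fin.toℕ-combine (reverse-if (orientation i) s) _)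
          (cong (λ δ → 2 ℕ.* toℕ (reverse-if (orientation i) s) ℕ.+ toℕ δ)
            (trans (cong (λ b′ → reverse-if b′ (reverse-if b ε)) e) (reverse-if-twice b ε))))

    childRank-orientation : ∀ {s t} ε δ → reverse-if (orientation i) s Fin.< reverse-if (orientation i) t →
      childRank (combine s ε) < childRank (combine t δ)
    childRank-orientation {s} {t} ε δ s<t rewrite permute-combine s ε | permute-combine t δ =
      Fin.combine-monoˡ-< _ _ s<t

  -- Copies 0 and 1 order different patterns oppositely. For equal patterns the twisted signs at 0,
  -- ..., N take both values, and one of them puts `d` before `c`.
  childRank-clash : ∀ {N} p {c d} → 1 ≤ N → c ≢ d → ∃[ i ] (i ≤ N × childRank N p i d < childRank N p i c)
  childRank-clash {N} p {c} {d} 1≤N c≢d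
    with s , ε , refl ← Fin.combine-surjective {2 ℕ.^ (M ℕ.* l)} {2} c
       | t , δ , refl ← Fin.combine-surjective {2 ℕ.^ (M ℕ.* l)} {2} d
    with Fin.<-cmp s t
  ... | tri< s<t _ _ = 1 , 1≤N , childRank-orientation N p 1 δ ε (opposite-anti s<t)
  ... | tri> _ _ t<s = 0 , z≤n , childRank-orientation N p 0 δ ε t<s
  ... | tri≈ _ refl _ =
    let b , e , e′ = reversed ε δ (λ e → c≢d (cong (combine s) e))
        i , i≤N , tw = twist-both (entry s p) 1≤N b
    in i , i≤N , subst₂ (λ δ ε → childRank N p i (combine s δ) < childRank N p i (combine s ε)) e e′
                   (childRank-twist N p i s tw)
    where
    reversed : ∀ (ε δ : Fin 2) → ε ≢ δ → ∃[ b ] (reverse-if b 0F ≡ δ × reverse-if b 1F ≡ ε)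
    reversed 0F 0F ne = contradiction refl ne
    reversed 0F 1F _  = 1F , refl , refl
    reversed 1F 0F _  = 0F , refl , refl
    reversed 1F 1F ne = contradiction refl ne

  -- One matrix serves all coordinates: the distinct cells (p t, i t) receive the signs b t and
  -- `fill` supplies the rest. The bounds by `l` keep all cells that are read inside the matrix.
  childRank-rich : ∀ {N k} (p : Fin k → Fin M) (i : Fin k → ℕ) (b : Fin k → Fin 2) →
    (∀ {s t} → p s ≡ p t → i s ≡ i t → s ≡ t) → N ≡ 0 ⊎ k ≤ N → N < l → (∀ t → i t < l) →
    ∃[ s ] ∀ t → childRank N (p t) (i t) (combine s (reverse-if (b t) 0F)) <
                 childRank N (p t) (i t) (combine s (reverse-if (b t) 1F))
  childRank-rich {N} p i b distinct small N<l i<l = s , λ t → childRank-twist N (p t) (i t) s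
    (trans (twist-cong {N = N} {i = i t} (λ j j≤N → entry-pattern-with f (p t) (ℕ.≤-<-trans j≤N N<l))
             (entry-pattern-with f (p t) (i<l t)))
           (twist-fill Fin._≟_ p i b distinct small t))
    where
    f = fill Fin._≟_ p i b
    s = pattern-with f

-- The type of the scheme

module SpecialType (em : ∀ {ℓ} → ExcludedMiddle ℓ) where

  -- The first coordinate of the decoded pair, so that each `s` recurs at every `pair s b`, as
  -- `Good` requires.
  rootSize : ℕ → ℕ
  rootSize k with em {P = ∃₂ λ s b → pair s b ≡ k}
  ... | yes (s , _) = s
  ... | no _        = 0

  rootSize-pair : ∀ s b → rootSize (pair s b) ≡ s
  rootSize-pair s b with em {P = ∃₂ λ s′ b′ → pair s′ b′ ≡ pair s b}
  ... | yes (s′ , b′ , e) = proj₁ (pair-injective {s′} {b′} e)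
  ... | no none           = contradiction (s , b , refl) none

  rootSize≤ : ∀ k → rootSize k ≤ k
  rootSize≤ k with em {P = ∃₂ λ s b → pair s b ≡ k}
  ... | yes (s , b , refl) = pair-≥₁ s b
  ... | no _               = z≤n

  blockCount : ℕ → ℕ → ℕ
  blockCount k m = 2 ℕ.^ (m ℕ.* suc k) ℕ.* 2

  blockCount≥2 : ∀ k m → 2 ≤ blockCount k m
  blockCount≥2 k m = ℕ.*-monoˡ-≤ 2 (ℕ.m^n>0 2 (m ℕ.* suc k))

  size : ℕ → ℕ
  size zero    = 1
  size (suc k) = rootSize k ℕ.+ (size k ∸ rootSize k) ℕ.* blockCount k (size k)

  -- Together with `rootSize k ≤ k` this keeps the root smaller than the block; then each step at
  -- least doubles a positive difference.
  k<size : ∀ k → k < size k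
  k<size zero    = s≤s z≤n
  k<size (suc k) = begin-strict
    suc k                                                   ≤⟨ k<size k ⟩
    size k                                                  ≡⟨ ℕ.m+[n∸m]≡n (ℕ.<⇒≤ r<m) ⟨
    rootSize k ℕ.+ d                                        <⟨ ℕ.+-monoʳ-< (rootSize k) d<d*n ⟩
    rootSize k ℕ.+ d ℕ.* blockCount k (size k)              ∎
    where
    open ℕ.≤-Reasoning
    d = size k ∸ rootSize k
    r<m = ℕ.≤-<-trans (rootSize≤ k) (k<size k)
    d<d*n : d < d ℕ.* blockCount k (size k)
    d<d*n = ℕ.m<m*n d (blockCount k (size k)) {{ℕ.>-nonZero (ℕ.m<n⇒0<n∸m r<m)}} (blockCount≥2 k (size k))

  -- n (k + 1) = 2 · 2^(m k · (k + 1)) blocks leave room for all sign patterns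
  -- on the m k nodes of k + 1 copies of the tree.
  specialType : SchemeType
  specialType = record
    { m      = size
    ; n      = λ { zero → 0 ; (suc k) → blockCount k (size k) }
    ; r      = λ { zero → 0 ; (suc k) → rootSize k }
    ; m-zero = refl
    ; n≥2    = λ k → blockCount≥2 k (size k)
    ; r<m    = λ k → ℕ.≤-<-trans (rootSize≤ k) (k<size k)
    ; m-suc  = λ _ → refl
    }

  good : Good specialType
  good s b = pair s b , pair-≥₂ s b , rootSize-pair s b

-- The sets of reals

uniform-bound : ∀ {k} (P : Fin k → ℕ → Set) → (∀ t {b c} → b ≤ c → P t b → P t c) →
                (∀ t → ∃[ b ] P t b) → ∃[ b ] ∀ t → P t b
uniform-bound {zero}  P mono f = 0 , λ ()
uniform-bound {suc k} P mono f =
  let b , p = f Fin.zero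
      c , q = uniform-bound (P ∘ Fin.suc) (mono ∘ Fin.suc) (f ∘ Fin.suc)
  in b ⊔ c , λ { Fin.zero    → mono Fin.zero (ℕ.m≤m⊔n b c) p
               ; (Fin.suc t) → mono (Fin.suc t) (ℕ.m≤n⊔m b c) (q t) }

lookup-extensional : ∀ {A : Set} {k} {v w : Vec A k} → (∀ t → lookup v t ≡ lookup w t) → v ≡ w
lookup-extensional {v = v} {w} e =
  trans (sym (Vec.tabulate∘lookup v)) (trans (Vec.tabulate-cong e) (Vec.tabulate∘lookup w))

toList-injective : ∀ {A : Set} {s} {D E : Vec A s} → toList D ≡ toList E → D ≡ E
toList-injective {D = D} {E} e = trans (sym (Vec.cast-is-id refl D)) (Vec.toList-injective refl D E e)

module EntangledSets (em : ∀ {ℓ} → ExcludedMiddle ℓ) (W : ω₁) (𝓕 : Pred (List (ω₁.Ord W)) 0ℓ)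
  (scheme : Schemes.IsConstructionScheme W (SpecialType.specialType em) 𝓕) where
  open Embedding em
  open Classical em
  open SpecialType em
  open Ordinals W
  open Positions em W specialType 𝓕 scheme hiding (increasing)

  -- Entry 0 is the number of the copy, so the child chosen at height k is entry k + 1. A node
  -- inside the root has one child, coded 0.
  code : ℕ → Ord × ℕ → Sequence
  code N (α , i) zero = i
  code N (α , i) (suc k) with step α k
  ... | inj₁ _       = 0
  ... | inj₂ (c , _) = childRank {l = suc k} N (position α k) i c

  code-branch : ∀ {N α i k c} → Branch α k c → code N (α , i) (suc k) ≡ childRank {l = suc k} N (position α k) i c
  code-branch {α = α} {k = k} b with step α k
  ... | inj₁ p        = contradiction b (Rooted⇒¬Branch refl p)
  ... | inj₂ (d , b′) with refl ← branch-unique b′ b refl = refl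

  code-rooted : ∀ {N α i k} → Rooted α k → code N (α , i) (suc k) ≡ 0
  code-rooted {α = α} {k = k} p with step α k
  ... | inj₁ _       = refl
  ... | inj₂ (_ , b) = contradiction b (Rooted⇒¬Branch refl p)

  code-suc-cong : ∀ {N α β i} k → position α (suc k) ≡ position β (suc k) →
                  code N (α , i) (suc k) ≡ code N (β , i) (suc k)
  code-suc-cong {N} {α} {β} {i} k e′ = go (step α k) (step β k)
    where
    e = position-pred k e′
    go : Rooted α k ⊎ ∃ (Branch α k) → Rooted β k ⊎ ∃ (Branch β k) →
         code N (α , i) (suc k) ≡ code N (β , i) (suc k)
    go (inj₁ p) (inj₁ q) = trans (code-rooted p) (sym (code-rooted q))
    go (inj₁ p) (inj₂ (_ , b)) = contradiction b (Rooted⇒¬Branch e p)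
    go (inj₂ (_ , b)) (inj₁ q) = contradiction b (Rooted⇒¬Branch (sym e) q)
    go (inj₂ (c , b)) (inj₂ (d , b′)) with refl ← branch-unique b b′ e′ =
      trans (code-branch b) (trans (cong (λ p → childRank N p i c) e) (sym (code-branch b′)))

  position⇒agree : ∀ {N α β} i k → position α k ≡ position β k →
                   Agree (suc k) (code N (α , i)) (code N (β , i))
  position⇒agree i k e zero    _         = refl
  position⇒agree i k e (suc j) (s≤s j<k) = code-suc-cong j (position-lower j<k e)

  -- By induction on the height: over a common node the rank determines the child.
  agree⇒position : ∀ {N α β i j} k → Agree (suc k) (code N (α , i)) (code N (β , j)) →
                   i ≡ j × position α k ≡ position β k
  agree⇒position {α = α} {β} zero    e = e 0 (s≤s z≤n) , position-zero α β
  agree⇒position {N} {α} {β} {i} {j} (suc k) e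
    with refl , e′ ← agree⇒position {N} {α} {β} {i} {j} k (λ l l<1+k → e l (ℕ.m<n⇒m<1+n l<1+k))
    = refl , go (step α k) (step β k)
    where
    go : Rooted α k ⊎ ∃ (Branch α k) → Rooted β k ⊎ ∃ (Branch β k) →
         position α (suc k) ≡ position β (suc k)
    go (inj₁ p) (inj₁ q) = rooted-position p q e′
    go (inj₁ p) (inj₂ (_ , b)) = contradiction b (Rooted⇒¬Branch e′ p)
    go (inj₂ (_ , b)) (inj₁ q) = contradiction b (Rooted⇒¬Branch (sym e′) q)
    go (inj₂ (c , b)) (inj₂ (d , b′)) with refl ← childRank-injective {l = suc k} N (position α k) i
         (trans (sym (code-branch b)) (trans (e (suc k) ℕ.≤-refl)
           (trans (code-branch b′) (cong (λ p → childRank N p i d) (sym e′))))) = branch-position b b′ e′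

  -- Agreement amounts to equal copies and equal positions, and neither depends on the orders of the
  -- children.
  agree-transfer : ∀ N M l x y → Agree l (code N x) (code N y) → Agree l (code M x) (code M y)
  agree-transfer N M zero    x y e j ()
  agree-transfer N M (suc l) (α , i) (β , j) e with agree⇒position {N} {α} {β} {i} {j} l e
  ... | refl , e′ = position⇒agree i l e′

  code-separating : ∀ N → Separating (code N)
  code-separating N (α , i) (β , j) e = cong₂ _,_
    (decidable-stable (α ≟ β) λ α≢β → let k , ne = position-separates α≢β in
      ne (proj₂ (agree⇒position {N} {α} {β} {i} {j} k (e (suc k)))))
    (proj₁ (agree⇒position {N} {α} {β} {i} {j} 0 (e 1)))

  -- The homeomorphic sets and the failure of entangledness

  real : ℕ → Ord × ℕ → ℝ
  real N x = embed (code N x)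

  real-injective : ∀ N {x y} → real N x ≈ᴿ real N y → x ≡ y
  real-injective N {x} {y} = index-unique (code-separating N) {real N x} {real N y} (λ _ → refl) (λ _ → refl)

  real-branch-< : ∀ N {α β i k c d} → position α k ≡ position β k → Branch α k c → Branch β k d →
    childRank {l = suc k} N (position α k) i c < childRank {l = suc k} N (position α k) i d →
    real N (α , i) <ᴿ real N (β , i)
  real-branch-< N {i = i} {k} {c} {d} e b b′ lt = embed-mono (suc k , position⇒agree i k e ,
    subst₂ _<_ (sym (code-branch b)) (trans (cong (λ p → childRank N p i d) e) (sym (code-branch b′))) lt)

  E : ℕ → Subsetᴿ
  E N = range (code N)

  E-uncountable : ∀ N → Uncountable (points (E N))
  E-uncountable N = uncountable-injection {S = setoid Ord} {T = points (E N)} record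
    { to        = λ α → real N (α , 0) , (α , 0) , λ _ → refl
    ; cong      = λ { refl _ → refl }
    ; injective = λ e → cong proj₁ (real-injective N e)
    } uncountable

  E-homeomorphic : ∀ N M → Homeomorphic (E N) (E M)
  E-homeomorphic N M = range-homeomorphic (agree-transfer N M) (agree-transfer M N) (code-separating N)

  -- The constant type fails for the tuples of all copies 0, ..., N of one ordinal: where two
  -- ordinals split, some copy orders them the wrong way.
  E-not-entangled : ∀ N → 1 ≤ N → ¬ KEntangled (suc N) (E N)
  E-not-entangled N 1≤N entangled = impossible (entangled (λ _ → Fin.zero) 𝒜 𝒜⊆ 𝒜-uncountable 𝒜-disjoint)
    where
    tuple : Ord → Fin (suc N) → ℝ
    tuple α t = real N (α , toℕ t)
    𝒜 : Pred (Fin (suc N) → ℝ) 0ℓ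
    𝒜 a = ∃[ α ] (∀ t → a t ≈ᴿ tuple α t)
    𝒜⊆ : ∀ a → 𝒜 a → [ E N ]^ (suc N) a
    𝒜⊆ a (α , e) = (λ t → (α , toℕ t) , e t) , λ s t s<t →
      <ᴿ-resp (tuple α s) (a s) (tuple α t) (a t) (≈ᴿ-sym (a s) (tuple α s) (e s)) (≈ᴿ-sym (a t) (tuple α t) (e t))
        -- The coordinates of a tuple differ in entry 0, the number of the copy, and increase with
        -- it.
        (embed-mono (0 , (λ _ ()) , s<t))
    𝒜-uncountable : Uncountable (Subsetoid (≋-setoid (suc N)) 𝒜)
    𝒜-uncountable = uncountable-injection {S = setoid Ord} {T = Subsetoid (≋-setoid (suc N)) 𝒜} record
      { to        = λ α → tuple α , α , λ _ _ → refl
      ; cong      = λ { refl _ _ → refl }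
      ; injective = λ e → cong proj₁ (real-injective N (e Fin.zero))
      } uncountable
    ≋-of-same : ∀ {a b α β} → (∀ t → a t ≈ᴿ tuple α t) → (∀ t → b t ≈ᴿ tuple β t) → α ≡ β → a ≋ b
    ≋-of-same {a} {b} {α} e e′ refl t = ≈ᴿ-trans (a t) (tuple α t) (b t) (e t) (≈ᴿ-sym (b t) (tuple α t) (e′ t))
    𝒜-disjoint : PairwiseDisjoint 𝒜
    𝒜-disjoint a b (α , e) (β , e′) a≉b s t aₛ≈bₜ = a≉b (≋-of-same {a} {b} e e′
      (cong proj₁ (index-unique (code-separating N) {a s} {b t} (e s) (e′ t) aₛ≈bₜ)))
    impossible : ¬ (∃₂ λ a b → 𝒜 a × 𝒜 b × ¬ (a ≋ b) × (∀ i → (a i <ᴿ b i) ⇔ (Fin.zero {1} ≡ Fin.zero)))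
    impossible (a , b , (α , e) , (β , e′) , a≉b , a<b) =
      let k , same , differ       = splitting λ α≡β → a≉b (≋-of-same {a} {b} e e′ α≡β)
          c , d , bα , bβ , c≢d   = splitting-branches same differ
          -- In copy `i` the child taken by `β` precedes the child taken by `α`.
          i , i≤N , clash         = childRank-clash {l = suc k} (position α k) 1≤N c≢d
          t                       = Fin.fromℕ< (s≤s i≤N)
          i≡t                     = sym (Fin.toℕ-fromℕ< (s≤s i≤N))
          β<α                     = real-branch-< N (sym same) bβ bα
                                      (subst₂ (λ p i → childRank N p i d < childRank N p i c) same i≡t clash)
          α<β                     = <ᴿ-resp (a t) (tuple α t) (b t) (tuple β t) (e t) (e′ t)
                                      (Equivalence.from (a<b t) refl)
      in <ᴿ-asym (tuple α t) (tuple β t) α<β β<α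

  -- Realising a prescribed type in an uncountable family

  module _ (capturing : FullyΔCapturing specialType 𝓕)
           (N k : ℕ) (small : N ≡ 0 ⊎ k ≤ N) (τ : Fin k → Fin 2)
           (𝒜 : Pred (Fin k → ℝ) 0ℓ) (𝒜⊆ : ∀ a → 𝒜 a → [ E N ]^ k a)
           (𝒜-uncountable : Uncountable (Subsetoid (≋-setoid k) 𝒜)) (𝒜-disjoint : PairwiseDisjoint 𝒜) where

    Realised : Set
    Realised = ∃₂ λ a b → 𝒜 a × 𝒜 b × ¬ (a ≋ b) × (∀ t → (a t <ᴿ b t) ⇔ (τ t ≡ Fin.zero))

    Tuple : Set
    Tuple = Vec (Ord × ℕ) k

    ord : Tuple → Fin k → Ord
    ord v t = proj₁ (lookup v t)

    copy : Tuple → Fin k → ℕ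
    copy v t = proj₂ (lookup v t)

    Represents : Tuple → (Fin k → ℝ) → Set
    Represents v a = ∀ t → a t ≈ᴿ real N (lookup v t)

    V : Pred Tuple 0ℓ
    V v = ∃[ a ] (𝒜 a × Represents v a)

    represents-unique : ∀ {v w a b} → Represents v a → Represents w b → a ≋ b → v ≡ w
    represents-unique {a = a} {b} ra rb a≋b = lookup-extensional λ t →
      index-unique (code-separating N) {a t} {b t} (ra t) (rb t) (a≋b t)

    V-uncountable : Uncountable (Subsetoid (setoid Tuple) V)
    V-uncountable = uncountable-injection {S = Subsetoid (≋-setoid k) 𝒜} {T = Subsetoid (setoid Tuple) V} record
      { to        = λ (a , a∈) → tuple a a∈ , a , a∈ , represents a a∈
      ; cong      = λ {(a , a∈)} {(b , b∈)} →
          represents-unique {tuple a a∈} {tuple b b∈} {a} {b} (represents a a∈) (represents b b∈)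
      ; injective = λ {(a , a∈)} {(b , b∈)} e t → let x = real N (lookup (tuple a a∈) t) in
          ≈ᴿ-trans (a t) x (b t) (represents a a∈ t) (≈ᴿ-sym (b t) x
            (subst (λ v → b t ≈ᴿ real N (lookup v t)) (sym e) (represents b b∈ t)))
      } 𝒜-uncountable
      where
      tuple : ∀ a → 𝒜 a → Tuple
      tuple a a∈ = tabulate λ t → proj₁ (proj₁ (𝒜⊆ a a∈) t)
      represents : ∀ a a∈ → Represents (tuple a a∈) a
      represents a a∈ t = subst (λ x → a t ≈ᴿ real N x)
        (sym (Vec.lookup∘tabulate (λ t → proj₁ (proj₁ (𝒜⊆ a a∈) t)) t)) (proj₂ (proj₁ (𝒜⊆ a a∈) t))

    -- Tuples increase as reals, not as ordinals, and an ordinal may occur in several copies; so the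
    -- support is sorted, may have fewer than k elements, and needs `place` to recover the
    -- coordinates.
    support : Tuple → List Ord
    support v = sort (List.tabulate (ord v))

    ord∈support : ∀ v t → ord v t ∈ support v
    ord∈support v t = ∈-sort⁺ (∈-tabulate⁺ t)

    support-increasing : ∀ v → Increasing (support v)
    support-increasing v = sort-increasing (List.tabulate (ord v))

    place : Tuple → Fin k → ℕ
    place v t = toℕ (index (ord∈support v t))

    -- The bound on the copy ensures that its column exists in the matrices with b + 1 columns used
    -- at height b.
    SeparatesPair : Tuple → Fin k → Fin k → ℕ → Set
    SeparatesPair v s t b = copy v s ≤ b × (position (ord v s) b ≡ position (ord v t) b → ord v s ≡ ord v t)

    Separates : Tuple → ℕ → Set
    Separates v b = ∀ s t → SeparatesPair v s t b

    separatesPair-mono : ∀ v s t {b c} → b ≤ c → SeparatesPair v s t b → SeparatesPair v s t c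
    separatesPair-mono v s t b≤c (≤b , same) = ℕ.≤-trans ≤b b≤c , λ e → same (position-lower b≤c e)

    separates-mono : ∀ v {b c} → b ≤ c → Separates v b → Separates v c
    separates-mono v b≤c sep s t = separatesPair-mono v s t b≤c (sep s t)

    separation : ∀ v → ∃[ b ] Separates v b
    separation v = uniform-bound (λ s b → ∀ t → SeparatesPair v s t b)
      (λ s b≤c sep t → separatesPair-mono v s t b≤c (sep t))
      λ s → uniform-bound (SeparatesPair v s) (separatesPair-mono v s) (pair-separation s)
      where
      pair-separation : ∀ s t → ∃[ b ] SeparatesPair v s t b
      pair-separation s t with ord v s ≟ ord v t
      ... | yes e = copy v s , ℕ.≤-refl , λ _ → e
      ... | no ne = let l , sep = position-separates ne in
        copy v s ⊔ l , ℕ.m≤m⊔n _ l , λ e → contradiction (position-lower (ℕ.m≤n⊔m _ l) e) sep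

    -- Only countably many kinds exist, so one has uncountably many tuples. As `kind` dominates the
    -- separating height, any height above it separates all tuples of that kind.
    kind : Tuple → ℕ
    kind v = pair (proj₁ (separation v)) (pair (encode (tabulate (copy v))) (encode (tabulate (place v))))

    separates-kind : ∀ v → Separates v (kind v)
    separates-kind v = separates-mono v (pair-≥₁ (proj₁ (separation v)) _) (proj₂ (separation v))

    tabulate-injective : ∀ {f g : Fin k → ℕ} → tabulate f ≡ tabulate g → ∀ t → f t ≡ g t
    tabulate-injective {f} {g} e t = trans (sym (Vec.lookup∘tabulate f t))
      (trans (cong (λ v → lookup v t) e) (Vec.lookup∘tabulate g t))

    kind-copies-places : ∀ v w → kind v ≡ kind w →
      tabulate (copy v) ≡ tabulate (copy w) × tabulate (place v) ≡ tabulate (place w)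
    kind-copies-places v w e =
      let _ , e′ = pair-injective {proj₁ (separation v)} {_} {proj₁ (separation w)} e
          e₁ , e₂ = pair-injective {encode (tabulate (copy v))} {_} {encode (tabulate (copy w))} e′
      in encode-injective e₁ , encode-injective e₂

    kind-copy : ∀ v w → kind v ≡ kind w → ∀ t → copy v t ≡ copy w t
    kind-copy v w e = tabulate-injective (proj₁ (kind-copies-places v w e))

    kind-place : ∀ v w → kind v ≡ kind w → ∀ t → place v t ≡ place w t
    kind-place v w e = tabulate-injective (proj₂ (kind-copies-places v w e))

    -- Places and copies rebuild the tuple from its support, so uncountably many tuples of one kind
    -- have uncountably many supports.
    kind-support : ∀ v w → kind v ≡ kind w → support v ≡ support w → v ≡ w
    kind-support v w e e′ = lookup-extensional λ t → cong₂ _,_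
      (index-resp e′ (ord∈support v t) (ord∈support w t) (kind-place v w e t)) (kind-copy v w e t)

    -- The root precedes the rest of the list, so a nonempty root must contain the least element.
    head∈root : ∀ {h A root x} → Increasing (h ∷ A) → x ∈ root → x ∈ h ∷ A →
                (_∈ root) ≪ ((h ∷ A) ∖ root) → h ∈ root
    head∈root _ x∈root (here refl) _ = x∈root
    head∈root {h} (h≺A ∷ _) x∈root (there x∈A) root≪ = decidable-stable em λ h∉root →
      ≺-asym (root≪ _ h x∈root (here refl , h∉root)) (All.lookup h≺A x∈A)

    head-unique : ∀ {g h A B} → Increasing (g ∷ A) → Increasing (h ∷ B) → g ∈ h ∷ B → h ∈ g ∷ A → g ≡ h
    head-unique _ _ (here g≡h) _ = g≡h
    head-unique _ _ _ (here h≡g) = sym h≡g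
    head-unique (g≺A ∷ _) (h≺B ∷ _) (there g∈B) (there h∈A) =
      contradiction (All.lookup h≺B g∈B) (≺-asym (All.lookup g≺A h∈A))

    record Member (κ : ℕ) (A : List Ord) : Set where
      constructor mkMember
      field
        {tuple}    : Tuple
        {point}    : Fin k → ℝ
        point∈     : 𝒜 point
        represents : Represents tuple point
        kind≡      : kind tuple ≡ κ
        support≡   : support tuple ≡ A

    open Member

    members-distinct : ∀ {κ A B} (M : Member κ A) (M′ : Member κ B) → A ≢ B → ¬ (point M ≋ point M′)
    members-distinct M M′ A≢B a≋b = A≢B (trans (sym (support≡ M)) (trans (cong support M≡M′) (support≡ M′)))
      where
      M≡M′ : tuple M ≡ tuple M′
      M≡M′ = represents-unique {tuple M} {tuple M′} {point M} {point M′} (represents M) (represents M′) a≋b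

    copy≡ : ∀ {κ A B} (M : Member κ A) (M′ : Member κ B) → ∀ t → copy (tuple M) t ≡ copy (tuple M′) t
    copy≡ M M′ = kind-copy (tuple M) (tuple M′) (trans (kind≡ M) (sym (kind≡ M′)))

    place≡ : ∀ {κ A B} (M : Member κ A) (M′ : Member κ B) → ∀ t → place (tuple M) t ≡ place (tuple M′) t
    place≡ M M′ = kind-place (tuple M) (tuple M′) (trans (kind≡ M) (sym (kind≡ M′)))

    -- If two members of one kind had the same least element, then the tuples would
    -- share a point, as that element has the same place and lies in the same copy.
    same-head : ∀ {κ h A B} → Member κ (h ∷ A) → Member κ (h ∷ B) → h ∷ A ≡ h ∷ B
    same-head {κ} {h} {A} {B} M M′ = decidable-stable em λ A≢B →
      𝒜-disjoint (point M) (point M′) (point∈ M) (point∈ M′) (members-distinct M M′ A≢B) t t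
        (≈ᴿ-trans (point M t) (real N (lookup (tuple M) t)) (point M′ t) (represents M t)
          (subst (λ x → real N x ≈ᴿ point M′ t) (sym same)
            (≈ᴿ-sym (point M′ t) (real N (lookup (tuple M′) t)) (represents M′ t))))
      where
      found : ∃[ t ] h ≡ ord (tuple M) t
      found = ∈-tabulate⁻ (∈-sort⁻ (subst (h ∈_) (sym (support≡ M)) (here refl)))
      t = proj₁ found
      first : place (tuple M) t ≡ 0
      first = first-place (support≡ M) (support-increasing (tuple M)) (ord∈support (tuple M) t) (sym (proj₂ found))
        where
        first-place : ∀ {xs x} → xs ≡ h ∷ A → Increasing xs → (x∈ : x ∈ xs) → x ≡ h → toℕ (index x∈) ≡ 0
        first-place refl inc x∈ refl = index-least inc x∈
      same : lookup (tuple M) t ≡ lookup (tuple M′) t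
      same = cong₂ _,_ (trans (sym (proj₂ found))
        (sym (index-resp (support≡ M′) (ord∈support (tuple M′) t) (here refl) (trans (sym (place≡ M M′ t)) first))))
        (copy≡ M M′ t)

    -- A nonempty root contains the least elements of both lists, which therefore coincide, and
    -- `same-head` applies.
    root-shared : ∀ {κ A B R x} → Increasing A → Increasing B → x ∈ R → x ∈ A → x ∈ B →
      (∀ {y} → y ∈ R → y ∈ A × y ∈ B) → (_∈ R) ≪ (A ∖ R) → (_∈ R) ≪ (B ∖ R) →
      Member κ A → Member κ B → A ≡ B
    root-shared {A = g ∷ A} {h ∷ B} A↑ B↑ x∈R x∈A x∈B R⊆ R≪A R≪B M M′
      with refl ← head-unique A↑ B↑ (proj₂ (R⊆ (head∈root A↑ x∈R x∈A R≪A))) (proj₁ (R⊆ (head∈root B↑ x∈R x∈B R≪B)))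
      = same-head M M′

    -- A captured family of a single kind

    module _ {κ l s} (κ≤l : κ ≤ l) (N≤l : N ≤ l)
             (D : Fin (SchemeType.n specialType (suc l)) → Vec Ord s)
             (members : ∀ j → Member κ (toList (D j))) (D-distinct : ∀ i j → i ≢ j → D i ≢ D j)
             (captured : ΔCaptured specialType 𝓕 (suc l) D) where
      open ΔCaptured captured

      private
        Index : Set
        Index = Fin (SchemeType.n specialType (suc l))

        child-index : Pattern {size l} {suc l} → Fin 2 → Index
        child-index = combine

        zero-pattern : Pattern {size l} {suc l}
        zero-pattern = pattern-with {size l} {suc l} λ _ _ → 0F

        v : Index → Tuple
        v j = tuple (members j)

        a : Index → Fin k → ℝ
        a j = point (members j)

      a-distinct : ∀ i j → i ≢ j → ¬ (a i ≋ a j)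
      a-distinct i j i≢j = members-distinct (members i) (members j) (D-distinct i j i≢j ∘ toList-injective)

      child-index≢ : ∀ s {ε δ} → ε ≢ δ → child-index s ε ≢ child-index s δ
      child-index≢ s {ε} {δ} ε≢δ e = ε≢δ (proj₂ (Fin.combine-injective s ε s δ e))

      -- Two distinct members cannot share a root element, so the conditions on tails govern every
      -- coordinate.
      root-empty : ∀ {x} → ¬ (x ∈ root)
      root-empty {x} x∈ = D-distinct i j i≢j (toList-injective
        (root-shared (increasing i) (increasing j) x∈ (proj₁ (split x∈)) (proj₂ (split x∈)) split
          (root≪tails i) (root≪tails j) (members i) (members j)))
        where
        i = child-index zero-pattern 0F
        j = child-index zero-pattern 1F
        i≢j = child-index≢ zero-pattern {0F} {1F} λ ()
        split : ∀ {y} → y ∈ root → y ∈ toList (D i) × y ∈ toList (D j)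
        split = Equivalence.from (ΔSystem i j i≢j _)

      beyond-root : ∀ (c : Fin s) → length root ≤ toℕ c
      beyond-root c = ℕ.≤-trans (ℕ.≤-reflexive (empty root root-empty)) z≤n
        where
        empty : ∀ (R : List Ord) → (∀ {x} → ¬ (x ∈ R)) → length R ≡ 0
        empty []      _    = refl
        empty (_ ∷ _) none = contradiction (here refl) none

      private
        -- A reference member: copies, places and nodes at height `l` are the same for all members
        -- and are read off here.
        j₀ : Index
        j₀ = child-index zero-pattern 0F

        located : ∀ j t → ∃[ c ] (lookup (D j) c ≡ ord (v j) t × toℕ c ≡ place (v j) t)
        located j t = lookup-index (D j) (sym (support≡ (members j))) (ord∈support (v j) t)

        spot : Fin k → Fin s
        spot t = proj₁ (located j₀ t)

      lookup-spot : ∀ j t → lookup (D j) (spot t) ≡ ord (v j) t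
      lookup-spot j t = let c , e , e′ = located j t in
        trans (cong (lookup (D j)) (Fin.toℕ-injective (trans (proj₂ (proj₂ (located j₀ t)))
          (trans (place≡ (members j₀) (members j) t) (sym e′))))) e

      same-node : ∀ i j t → position (ord (v i) t) l ≡ position (ord (v j) t) l
      same-node i j t with i Fin.≟ j
      ... | yes refl = refl
      ... | no i≢j   = subst₂ (λ α β → position α l ≡ position β l) (lookup-spot i t) (lookup-spot j t)
        (Δ⇒position (Δ-on-tails i j i≢j (spot t) (beyond-root (spot t))))

      own-branch : ∀ j t → Branch (ord (v j) t) l j
      own-branch j t = Ξ⇒Branch j (subst (λ α → IsΞ specialType 𝓕 α (suc l) (+ toℕ j)) (lookup-spot j t)
        (Ξ-on-tails j (spot t) (beyond-root (spot t))))

      node₀ : Fin k → Fin (size l)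
      node₀ t = position (ord (v j₀) t) l

      separated : Separates (v j₀) l
      separated = separates-mono (v j₀) (ℕ.≤-trans (ℕ.≤-reflexive (kind≡ (members j₀))) κ≤l) (separates-kind (v j₀))

      -- Height `l` separates, so equal nodes mean equal ordinals; in the same copy these give equal
      -- reals, but the tuple is strictly increasing.
      node₀-distinct : ∀ {s t} → node₀ s ≡ node₀ t → copy (v j₀) s ≡ copy (v j₀) t → s ≡ t
      node₀-distinct {s} {t} e e′ = lookup-injective s t (cong₂ _,_ (proj₂ (separated s t) e) e′)
        where
        lookup-< : ∀ s t → s Fin.< t → lookup (v j₀) s ≢ lookup (v j₀) t
        lookup-< s t s<t e = <ᴿ-irrefl (a j₀ s) (a j₀ t)
          (≈ᴿ-trans (a j₀ s) (real N (lookup (v j₀) s)) (a j₀ t) (represents (members j₀) s)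
            (subst (λ x → real N x ≈ᴿ a j₀ t) (sym e)
              (≈ᴿ-sym (a j₀ t) (real N (lookup (v j₀) t)) (represents (members j₀) t))))
          (proj₂ (𝒜⊆ (a j₀) (point∈ (members j₀))) s t s<t)
        lookup-injective : ∀ s t → lookup (v j₀) s ≡ lookup (v j₀) t → s ≡ t
        lookup-injective s t e with Fin.<-cmp s t
        ... | tri< s<t _ _ = contradiction e (lookup-< s t s<t)
        ... | tri≈ _ s≡t _ = s≡t
        ... | tri> _ _ t<s = contradiction (sym e) (lookup-< t s t<s)

      a-< : ∀ i j t →
            childRank {l = suc l} N (node₀ t) (copy (v j₀) t) i <
            childRank {l = suc l} N (node₀ t) (copy (v j₀) t) j →
            a i t <ᴿ a j t
      a-< i j t lt = <ᴿ-resp (real N (lookup (v i) t)) (a i t) (real N (lookup (v j) t)) (a j t)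
        (≈ᴿ-sym (a i t) (real N (lookup (v i) t)) (represents (members i) t))
        (≈ᴿ-sym (a j t) (real N (lookup (v j) t)) (represents (members j) t))
        (subst (λ c → real N (lookup (v i) t) <ᴿ real N (ord (v j) t , c)) (copy≡ (members i) (members j) t)
          (real-branch-< N (same-node i j t) (own-branch i t) (own-branch j t)
            (subst₂ (λ p c → childRank N p c i < childRank N p c j)
              (same-node j₀ i t) (copy≡ (members j₀) (members i) t) lt)))

      -- Member j takes the j-th child in every coordinate. With `s` chosen for the signs `τ`, the
      -- members at (s,0) and (s,1) therefore compare as prescribed.
      realised : Realised
      realised =
        let s , rich = childRank-rich {l = suc l} {N} node₀ (copy (v j₀)) τ node₀-distinct small (s≤s N≤l)
                         (λ t → s≤s (proj₁ (separated t t)))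
            i = child-index s 0F
            j = child-index s 1F
        in a i , a j , point∈ (members i) , point∈ (members j) , a-distinct i j (child-index≢ s {0F} {1F} λ ()) ,
           λ t → compare-by s t (τ t) (rich t)
        where
        compare-by : ∀ s t b →
          childRank {l = suc l} N (node₀ t) (copy (v j₀) t) (child-index s (reverse-if b 0F)) <
          childRank {l = suc l} N (node₀ t) (copy (v j₀) t) (child-index s (reverse-if b 1F)) →
          (a (child-index s 0F) t <ᴿ a (child-index s 1F) t) ⇔ (b ≡ Fin.zero)
        compare-by s t 0F lt = mk⇔ (λ _ → refl) (λ _ → a-< _ _ t lt)
        -- Under the sign 1 the inequality `lt` runs from (s,1) to (s,0), which refutes the opposite
        -- comparison.
        compare-by s t 1F lt = mk⇔ (λ i<j → contradiction (a-< (child-index s 1F) (child-index s 0F) t lt)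
          (<ᴿ-asym (a (child-index s 0F) t) (a (child-index s 1F) t) i<j)) λ ()

    one-kind : ∀ κ → Uncountable (Subsetoid (setoid Tuple) (λ v → V v × kind v ≡ κ)) → Realised
    -- Capture happens at a level l + 1 with l ≥ N and l ≥ κ: the first keeps the columns 0, ..., N
    -- inside the matrix, the second makes height l separate the tuples.
    one-kind κ fibre-uncountable = from-capture (capturing 𝒮 𝒮↑ 𝒮-uncountable (N ⊔ κ))
      where
      𝒮 : Pred (List Ord) 0ℓ
      𝒮 A = Member κ A
      𝒮↑ : ∀ A → 𝒮 A → Increasing A
      𝒮↑ A M = subst Increasing (support≡ M) (support-increasing (tuple M))
      𝒮-uncountable : Uncountable (Subsetoid (setoid (List Ord)) 𝒮)
      𝒮-uncountable = uncountable-injection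
        {S = Subsetoid (setoid Tuple) (λ v → V v × kind v ≡ κ)} {T = Subsetoid (setoid (List Ord)) 𝒮} record
        { to        = λ (v , (a , a∈ , rep) , e) → support v , mkMember a∈ rep e refl
        ; cong      = cong support
        ; injective = λ {(v , _ , e)} {(w , _ , e′)} → kind-support v w (trans e (sym e′))
        } fibre-uncountable
      from-capture : (∃[ l ] (N ⊔ κ < l × (∃₂ λ s (D : Fin (SchemeType.n specialType l) → Vec Ord s) →
          (∀ j → 𝒮 (toList (D j))) × (∀ i j → i ≢ j → D i ≢ D j) × ΔCaptured specialType 𝓕 l D))) →
        Realised
      from-capture (suc l , s≤s N⊔κ≤l , s , D , members , D-distinct , captured) =
        realised (ℕ.≤-trans (ℕ.m≤n⊔m N κ) N⊔κ≤l) (ℕ.≤-trans (ℕ.m≤m⊔n N κ) N⊔κ≤l) D members D-distinct captured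

    entangles : Realised
    entangles = let κ , fibre-uncountable = uncountable-fibre V kind V-uncountable in one-kind κ fibre-uncountable

  E-entangled : FullyΔCapturing specialType 𝓕 → ∀ N k → N ≡ 0 ⊎ k ≤ N → KEntangled k (E N)
  E-entangled capturing N k small τ 𝒜 𝒜⊆ 𝒜-uncountable 𝒜-disjoint =
    entangles capturing N k small τ 𝒜 𝒜⊆ 𝒜-uncountable 𝒜-disjoint

mainTheorem5 : (∀ {ℓ} → ExcludedMiddle ℓ) → (W : ω₁) → FCAΔ W →
    Σ[ E ∈ (ℕ → Subsetᴿ) ] ((∀ (n : ℕ) → Uncountable (points (E n))) ×
    (∀ (i j : ℕ) → Homeomorphic (E i) (E j)) ×
    Entangled (E 0) ×
    (¬ KEntangled 2 (E 1)) ×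
    (∀ (n : ℕ) → 2 ≤ n → KEntangled n (E n) × (¬ KEntangled (suc n) (E n))))
mainTheorem5 em W fca =
  let 𝓕 , scheme , capturing = fca (SpecialType.specialType em) (SpecialType.good em)
      open EntangledSets em W 𝓕 scheme
  in E , E-uncountable , E-homeomorphic ,
     -- For `N = 0` nothing is twisted, so `k` is unrestricted.
     (λ k _ → E-entangled capturing 0 k (inj₁ refl)) ,
     E-not-entangled 1 ℕ.≤-refl ,
     λ n 2≤n → E-entangled capturing n n (inj₂ ℕ.≤-refl) , E-not-entangled n (ℕ.<⇒≤ 2≤n)
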